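{- For every integer $n\geq 3$, \[ S_{\triangle}(n)\leq\left\lfloor \frac{2}{3}(n-1)^{2}-\frac{5}{3}\right\rfloor . \]
   Context: For a finite set $P$ of points in the Euclidean plane, $S_{\triangle}(P)$ denotes the number of (unordered) triplets of points of $P$ that are the vertices of an isosceles right triangle (nondegenerate, of any size and orientation). For a positive integer $n$, $S_{\triangle}(n)=\max_{|P|=n}S_{\triangle}(P)$, the maximum being over all sets $P$ of $n$ points in the plane. -}

module Defs where

open import Algebra.Bundles using (CommutativeMonoid)
open import Data.Nat as ℕ using (ℕ; zero; suc)
import Data.Nat.Properties as ℕ
open import Data.Integer as ℤ using ()
import Data.Integer.Properties as ℤ
import Data.Rational.Unnormalised as ℚᵘ
open import Data.Rational as ℚ
  using (ℚ; 0ℚ; 1ℚ; ½; _+_; _*_; _-_; -_; ∣_∣; _<_; _≤_; 1/_; NonZero; Positive)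
open import Data.Rational.Properties as ℚ using (module ≤-Reasoning)
open import Data.Fin as Fin using (Fin; zero; suc; toℕ; combine)
import Data.Fin.Properties as Fin
open import Data.List using (List; length; lookup; filter; allFin; cartesianProduct)
open import Data.List.Membership.Propositional using (_∈_)
open import Data.List.Membership.Propositional.Properties
  using (∈-allFin; ∈-cartesianProduct⁺; ∈-filter⁺; ∈-filter⁻; ∈-lookup)
open import Data.List.Relation.Unary.Unique.Propositional using (Unique)
open import Data.List.Relation.Unary.Unique.Propositional.Properties
  using (allFin⁺; cartesianProduct⁺; filter⁺)
import Data.List.Relation.Unary.AllPairs as AllPairs
import Data.List.Relation.Unary.All as All
open import Data.Product using (_×_; _,_; ∃; ∃-syntax; proj₁; proj₂)
open import Data.Sum using (_⊎_; inj₁; inj₂)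
open import Data.Empty using (⊥-elim)
open import Function using (_∘_; _⇔_; mk⇔; Injective)
open import Relation.Nullary using (¬_; Dec; yes; no)
open import Relation.Nullary.Decidable using (¬¬-excluded-middle)
open import Relation.Binary.PropositionalEquality
  using (_≡_; refl; sym; trans; cong; cong₂; subst; module ≡-Reasoning)
open import Algebra.Properties.CommutativeSemigroup
  (CommutativeMonoid.commutativeSemigroup ℚ.+-0-commutativeMonoid) using (interchange)

------------------------------------------------------------------------
-- Real numbers: Cauchy sequences of rationals, compared up to null
-- sequences.

Cauchy : (ℕ → ℚ) → Set
Cauchy x = ∀ ε → 0ℚ < ε →
  ∃[ N ] ∀ m n → N ℕ.≤ m → N ℕ.≤ n → ∣ x m - x n ∣ < ε

record ℝ : Set where
  constructor mkℝ
  field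
    seq    : ℕ → ℚ
    cauchy : Cauchy seq

open ℝ public

infix 4 _≃_
infixl 6 _+ᵣ_ _-ᵣ_
infixl 7 _*ᵣ_

record _≃_ (x y : ℝ) : Set where
  constructor mk≃
  field
    null : ∀ ε → 0ℚ < ε →
      ∃[ N ] ∀ n → N ℕ.≤ n → ∣ seq x n - seq y n ∣ < ε

open _≃_ public

sum-of-differences : ∀ a b c d → (a - b) + (c - d) ≡ (a + c) - (b + d)
sum-of-differences a b c d =
  trans (interchange a (- b) c (- d))
        (cong (λ p → (a + c) + p) (sym (ℚ.neg-distrib-+ b d)))

difference+ : ∀ a b → a ≡ (a - b) + b
difference+ a b = sym
  (trans (ℚ.+-assoc a (- b) b)
    (trans (cong (a +_) (ℚ.+-inverseˡ b)) (ℚ.+-identityʳ a)))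

difference-of-products : ∀ a b c d → a * (c - d) + d * (a - b) ≡ a * c - b * d
difference-of-products a b c d = begin
  a * (c - d) + d * (a - b)              ≡⟨ cong₂ _+_ (distrib- a c d) (distrib- d a b) ⟩
  (a * c - a * d) + (d * a - d * b)      ≡⟨ cong₂ (λ p q → (a * c - a * d) + (p - q)) (ℚ.*-comm d a) (ℚ.*-comm d b) ⟩
  (a * c - a * d) + (a * d - b * d)      ≡⟨ sym (ℚ.+-assoc (a * c - a * d) (a * d) (- (b * d))) ⟩
  ((a * c - a * d) + a * d) - b * d      ≡⟨ cong (_- b * d) (sym (difference+ (a * c) (a * d))) ⟩
  a * c - b * d                          ∎
  where
  open ≡-Reasoning
  distrib- : ∀ p q r → p * (q - r) ≡ p * q - p * r
  distrib- p q r = trans (ℚ.*-distribˡ-+ p q (- r))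
                     (cong (p * q +_) (sym (ℚ.neg-distribʳ-* p r)))

0<½ε : ∀ {ε} → 0ℚ < ε → 0ℚ < ½ * ε
0<½ε {ε} 0<ε = subst (_< ½ * ε) (ℚ.*-zeroʳ ½) (ℚ.*-monoʳ-<-pos ½ 0<ε)

½ε+½ε : ∀ ε → ½ * ε + ½ * ε ≡ ε
½ε+½ε ε = trans (sym (ℚ.*-distribʳ-+ ε ½ ½)) (ℚ.*-identityˡ ε)

≤½+<½ : ∀ {p a b} ε → ∣ p ∣ ≤ a + b → a < ½ * ε → b < ½ * ε → ∣ p ∣ < ε
≤½+<½ ε p≤ a< b< =
  subst (_ <_) (½ε+½ε ε) (ℚ.≤-<-trans p≤ (ℚ.+-mono-< a< b<))

⊔ˡ : ∀ {a b n} → a ℕ.⊔ b ℕ.≤ n → a ℕ.≤ n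
⊔ˡ {a} {b} = ℕ.≤-trans (ℕ.m≤m⊔n a b)

⊔ʳ : ∀ {a b n} → a ℕ.⊔ b ℕ.≤ n → b ℕ.≤ n
⊔ʳ {a} {b} = ℕ.≤-trans (ℕ.m≤n⊔m a b)

EventuallyBounded : (ℕ → ℚ) → Set
EventuallyBounded x =
  ∃[ B ] Positive B × (∃[ N ] ∀ n → N ℕ.≤ n → ∣ x n ∣ ≤ B)

cauchy⇒bounded : ∀ {x} → Cauchy x → EventuallyBounded x
cauchy⇒bounded {x} cx with cx 1ℚ (ℚ.positive⁻¹ 1ℚ)
... | N , h =
  1ℚ + ∣ x N ∣
  , ℚ.pos+nonNeg⇒pos 1ℚ ∣ x N ∣ {{ℚ.∣-∣-nonNeg (x N)}}
  , N , λ n n≥ → begin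
      ∣ x n ∣                     ≡⟨ cong ∣_∣ (difference+ (x n) (x N)) ⟩
      ∣ (x n - x N) + x N ∣       ≤⟨ ℚ.∣p+q∣≤∣p∣+∣q∣ (x n - x N) (x N) ⟩
      ∣ x n - x N ∣ + ∣ x N ∣     ≤⟨ ℚ.+-monoˡ-≤ ∣ x N ∣ (ℚ.<⇒≤ (h n N n≥ ℕ.≤-refl)) ⟩
      1ℚ + ∣ x N ∣                ∎
  where open ≤-Reasoning

scale : ∀ B .{{_ : Positive B}} {ε} → 0ℚ < ε →
        ∃[ δ ] 0ℚ < δ × B * δ ≡ ε
scale B {ε} 0<ε = 1/B * ε , 0<δ , B*δ≡ε
  where
  instance
    nz : NonZero B
    nz = ℚ.pos⇒nonZero B
  1/B = 1/ B
  instance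
    1/B-pos : Positive 1/B
    1/B-pos = ℚ.1/pos⇒pos B
  0<δ : 0ℚ < 1/B * ε
  0<δ = subst (_< 1/B * ε) (ℚ.*-zeroʳ 1/B) (ℚ.*-monoʳ-<-pos 1/B 0<ε)
  B*δ≡ε : B * (1/B * ε) ≡ ε
  B*δ≡ε = trans (sym (ℚ.*-assoc B 1/B ε))
            (trans (cong (_* ε) (ℚ.*-inverseʳ B)) (ℚ.*-identityˡ ε))

bound-* : ∀ B .{{_ : Positive B}} {δ ε} p q →
          B * δ ≡ ε → ∣ p ∣ ≤ B → ∣ q ∣ < δ → ∣ p * q ∣ < ε
bound-* B {δ} {ε} p q Bδ≡ε p≤B q<δ = begin-strict
  ∣ p * q ∣      ≡⟨ ℚ.∣p*q∣≡∣p∣*∣q∣ p q ⟩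
  ∣ p ∣ * ∣ q ∣  ≤⟨ ℚ.*-monoʳ-≤-nonNeg ∣ q ∣ {{ℚ.∣-∣-nonNeg q}} p≤B ⟩
  B * ∣ q ∣      <⟨ ℚ.*-monoʳ-<-pos B q<δ ⟩
  B * δ          ≡⟨ Bδ≡ε ⟩
  ε              ∎
  where open ≤-Reasoning

-- Abstract, since unfolding these proofs makes type checking very slow.
abstract
  +-cauchy : ∀ {x y} → Cauchy x → Cauchy y → Cauchy (λ n → x n + y n)
  +-cauchy {x} {y} cx cy ε 0<ε
    with cx (½ * ε) (0<½ε 0<ε) | cy (½ * ε) (0<½ε 0<ε)
  ... | M , hx | N , hy = M ℕ.⊔ N , λ m n m≥ n≥ →
    ≤½+<½ ε
      (subst (λ p → ∣ p ∣ ≤ ∣ x m - x n ∣ + ∣ y m - y n ∣)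
        (sum-of-differences (x m) (x n) (y m) (y n))
        (ℚ.∣p+q∣≤∣p∣+∣q∣ (x m - x n) (y m - y n)))
      (hx m n (⊔ˡ m≥) (⊔ˡ n≥)) (hy m n (⊔ʳ {M} m≥) (⊔ʳ {M} n≥))

  neg-cauchy : ∀ {x} → Cauchy x → Cauchy (λ n → - x n)
  neg-cauchy {x} cx ε 0<ε with cx ε 0<ε
  ... | N , h = N , λ m n m≥ n≥ →
    subst (_< ε)
      (trans (sym (ℚ.∣-p∣≡∣p∣ (x m - x n)))
             (cong ∣_∣ (ℚ.neg-distrib-+ (x m) (- x n))))
      (h m n m≥ n≥)

  *-cauchy : ∀ {x y} → Cauchy x → Cauchy y → Cauchy (λ n → x n * y n)
  *-cauchy {x} {y} cx cy ε 0<ε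
    with cauchy⇒bounded cx | cauchy⇒bounded cy
  ... | A , A>0 , M₁ , bx | B , B>0 , M₂ , by
    with scale A {{A>0}} (0<½ε 0<ε) | scale B {{B>0}} (0<½ε 0<ε)
  ... | δ , 0<δ , Aδ | η , 0<η , Bη
    with cy δ 0<δ | cx η 0<η
  ... | N₁ , hy | N₂ , hx =
    (M₁ ℕ.⊔ M₂) ℕ.⊔ (N₁ ℕ.⊔ N₂) , λ m n m≥ n≥ →
    ≤½+<½ ε
      (subst (λ p → ∣ p ∣ ≤ ∣ x m * (y m - y n) ∣ + ∣ y n * (x m - x n) ∣)
        (difference-of-products (x m) (x n) (y m) (y n))
        (ℚ.∣p+q∣≤∣p∣+∣q∣ (x m * (y m - y n)) (y n * (x m - x n))))
      (bound-* A {{A>0}} (x m) (y m - y n) Aδ (bx m (⊔ˡ {M₁} (⊔ˡ m≥)))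
        (hy m n (⊔ˡ {N₁} (⊔ʳ {M₁ ℕ.⊔ M₂} m≥)) (⊔ˡ {N₁} (⊔ʳ {M₁ ℕ.⊔ M₂} n≥))))
      (bound-* B {{B>0}} (y n) (x m - x n) Bη (by n (⊔ʳ {M₁} (⊔ˡ n≥)))
        (hx m n (⊔ʳ {N₁} (⊔ʳ {M₁ ℕ.⊔ M₂} m≥)) (⊔ʳ {N₁} (⊔ʳ {M₁ ℕ.⊔ M₂} n≥))))

  const-cauchy : ∀ q → Cauchy (λ _ → q)
  const-cauchy q ε 0<ε = 0 , λ _ _ _ _ →
    subst (_< ε) (sym (cong ∣_∣ (ℚ.+-inverseʳ q))) 0<ε

_+ᵣ_ _*ᵣ_ _-ᵣ_ : ℝ → ℝ → ℝ
x +ᵣ y = mkℝ (λ n → seq x n + seq y n) (+-cauchy {seq x} {seq y} (cauchy x) (cauchy y))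
x *ᵣ y = mkℝ (λ n → seq x n * seq y n) (*-cauchy {seq x} {seq y} (cauchy x) (cauchy y))
x -ᵣ y = mkℝ (λ n → seq x n - seq y n)
  (+-cauchy {seq x} {λ n → - seq y n} (cauchy x) (neg-cauchy {seq y} (cauchy y)))

fromℚ : ℚ → ℝ
fromℚ q = mkℝ (λ _ → q) (const-cauchy q)

0ᵣ : ℝ
0ᵣ = fromℚ 0ℚ

------------------------------------------------------------------------
-- The Euclidean plane

record Point : Set where
  constructor pt
  field
    xc yc : ℝ

open Point public

infix 4 _≈ₚ_

_≈ₚ_ : Point → Point → Set
A ≈ₚ B = xc A ≃ xc B × yc A ≃ yc B

-- Two lengths are equal exactly when their squares are.
dist² : Point → Point → ℝ
dist² A B = (xc B -ᵣ xc A) *ᵣ (xc B -ᵣ xc A) +ᵣ (yc B -ᵣ yc A) *ᵣ (yc B -ᵣ yc A)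

-- The scalar product of the vectors AB and AC.
dot : Point → Point → Point → ℝ
dot A B C = (xc B -ᵣ xc A) *ᵣ (xc C -ᵣ xc A) +ᵣ (yc B -ᵣ yc A) *ᵣ (yc C -ᵣ yc A)

-- The determinant of the vectors AB and AC.
det : Point → Point → Point → ℝ
det A B C = (xc B -ᵣ xc A) *ᵣ (yc C -ᵣ yc A) -ᵣ (yc B -ᵣ yc A) *ᵣ (xc C -ᵣ xc A)

Nondegenerate : Point → Point → Point → Set
Nondegenerate A B C = ¬ (det A B C ≃ 0ᵣ)

Right : Point → Point → Point → Set
Right A B C = dot A B C ≃ 0ᵣ ⊎ dot B C A ≃ 0ᵣ ⊎ dot C A B ≃ 0ᵣ

Isosceles : Point → Point → Point → Set
Isosceles A B C =
  dist² A B ≃ dist² A C ⊎ dist² B C ≃ dist² B A ⊎ dist² C A ≃ dist² C B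

record IsoscelesRight (A B C : Point) : Set where
  constructor mkIsoscelesRight
  field
    nondegenerate : Nondegenerate A B C
    isosceles     : Isosceles A B C
    right         : Right A B C

open IsoscelesRight public

------------------------------------------------------------------------
-- Counting isosceles right triangles

record Size {A : Set} (Q : A → Set) (m : ℕ) : Set where
  constructor mkSize
  field
    elements : List A
    unique   : Unique elements
    exact    : ∀ a → a ∈ elements ⇔ Q a
    size     : length elements ≡ m

-- A set of n points, given by an enumeration without repetition.
record PointSet (n : ℕ) : Set where
  constructor mkPointSet
  field
    point    : Fin n → Point
    distinct : Injective _≡_ _≈ₚ_ point

open PointSet public

Triple : ℕ → Set
Triple n = Fin n × Fin n × Fin n

-- Each unordered triplet is represented by its increasing enumeration.
IsoscelesRightTriple : ∀ {n} → PointSet n → Triple n → Set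
IsoscelesRightTriple P (i , j , k) =
  i Fin.< j × j Fin.< k × IsoscelesRight (point P i) (point P j) (point P k)

-- "S△(P) = m".  A relation, because equality of reals is not decidable
-- constructively, so no function computes this number.
S△[_]≡_ : ∀ {n} → PointSet n → ℕ → Set
S△[ P ]≡ m = Size (IsoscelesRightTriple P) m

-- "S△(n) = s": s is the maximum of S△(P) over all sets P of n points.
record S△_≡_ (n s : ℕ) : Set where
  field
    attained : ∃[ P ] S△[_]≡_ {n} P s
    maximal  : ∀ (P : PointSet n) m → S△[ P ]≡ m → m ℕ.≤ s

------------------------------------------------------------------------
-- Existence (up to double negation) and uniqueness of S△(n)

private
  ¬¬-Π : ∀ {n} {Q : Fin n → Set} → (∀ i → ¬ ¬ Q i) → ¬ ¬ (∀ i → Q i)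
  ¬¬-Π {zero}  h ¬q = ¬q λ ()
  ¬¬-Π {suc n} h ¬q =
    h zero λ q₀ → ¬¬-Π (h ∘ suc) λ qs → ¬q λ { zero → q₀ ; (suc i) → qs i }

  allTriples : ∀ n → List (Triple n)
  allTriples n = cartesianProduct (allFin n) (cartesianProduct (allFin n) (allFin n))

  ∈-allTriples : ∀ {n} (t : Triple n) → t ∈ allTriples n
  ∈-allTriples (i , j , k) =
    ∈-cartesianProduct⁺ (∈-allFin i) (∈-cartesianProduct⁺ (∈-allFin j) (∈-allFin k))

  allTriples-unique : ∀ n → Unique (allTriples n)
  allTriples-unique n =
    cartesianProduct⁺ (allFin⁺ n) (cartesianProduct⁺ (allFin⁺ n) (allFin⁺ n))

  count : ∀ {n} (P : PointSet n) → (∀ t → Dec (IsoscelesRightTriple P t)) → ∃[ m ] S△[ P ]≡ m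
  count {n} P dec = _ , mkSize
    (filter dec (allTriples n))
    (filter⁺ dec (allTriples-unique n))
    (λ t → mk⇔ (λ t∈ → proj₂ (∈-filter⁻ dec {xs = allTriples n} t∈))
               (∈-filter⁺ dec (∈-allTriples t)))
    refl

  lookup-injective : ∀ {A : Set} {xs : List A} → Unique xs →
                     Injective _≡_ _≡_ (lookup xs)
  lookup-injective (_  AllPairs.∷ _) {zero}  {zero}  _  = refl
  lookup-injective (x∉ AllPairs.∷ _) {zero}  {suc j} eq = ⊥-elim (All.lookup x∉ (∈-lookup j) eq)
  lookup-injective (x∉ AllPairs.∷ _) {suc i} {zero}  eq = ⊥-elim (All.lookup x∉ (∈-lookup i) (sym eq))
  lookup-injective (_  AllPairs.∷ u) {suc i} {suc j} eq = cong suc (lookup-injective u eq)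

  encode : ∀ {n} → Triple n → Fin (n ℕ.* (n ℕ.* n))
  encode (i , j , k) = combine i (combine j k)

  encode-injective : ∀ {n} → Injective _≡_ _≡_ (encode {n})
  encode-injective {n} {i , j , k} {i′ , j′ , k′} eq
    with refl , eq′ ← Fin.combine-injective i (combine j k) i′ (combine j′ k′) eq
    with refl , refl ← Fin.combine-injective j k j′ k′ eq′ = refl

  count-bounded : ∀ {n m} (P : PointSet n) → S△[ P ]≡ m → m ℕ.≤ n ℕ.* (n ℕ.* n)
  count-bounded P (mkSize ts uniq _ refl) =
    Fin.injective⇒≤ {f = encode ∘ lookup ts}
      (lookup-injective uniq ∘ encode-injective)

  ∣-∣≡0⇒≡ : ∀ p q → ∣ p - q ∣ ≡ 0ℚ → p ≡ q
  ∣-∣≡0⇒≡ p q eq = trans (difference+ p q)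
    (trans (cong (_+ q) (ℚ.∣p∣≡0⇒p≡0 (p - q) eq)) (ℚ.+-identityˡ q))

  fromℚ-injective : Injective _≡_ _≃_ fromℚ
  fromℚ-injective {p} {q} p≃q with ∣ p - q ∣ ℚ.≟ 0ℚ
  ... | yes eq = ∣-∣≡0⇒≡ p q eq
  ... | no  ≢0 with null p≃q ∣ p - q ∣ (ℚ.≰⇒> λ ≤0 → ≢0 (ℚ.≤-antisym ≤0 (ℚ.0≤∣p∣ (p - q))))
  ...   | N , h = ⊥-elim (ℚ.<-irrefl refl (h N ℕ.≤-refl))

  fromℕ : ℕ → ℚᵘ.ℚᵘ
  fromℕ a = ℚᵘ.mkℚᵘ (ℤ.+ a) 0

  fromℕ-injective : ∀ {a b} → fromℚ (ℚ.fromℚᵘ (fromℕ a)) ≃ fromℚ (ℚ.fromℚᵘ (fromℕ b)) → a ≡ b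
  fromℕ-injective {a} {b} eq
    with ℚᵘ.*≡* e ← ℚ.fromℚᵘ-injective {fromℕ a} {fromℕ b} (fromℚ-injective eq) =
    ℤ.+-injective (ℤ.*-cancelʳ-≡ (ℤ.+ a) (ℤ.+ b) ℤ.1ℤ e)

  collinear : ∀ n → PointSet n
  collinear n = mkPointSet
    (λ i → pt (fromℚ (ℚ.fromℚᵘ (fromℕ (toℕ i)))) 0ᵣ)
    (λ eq → Fin.toℕ-injective (fromℕ-injective (proj₁ eq)))

  ¬¬-maximum : ∀ {Q : ℕ → Set} B → (∀ m → Q m → m ℕ.≤ B) → ∃ Q →
               ¬ ¬ (∃[ s ] Q s × (∀ m → Q m → m ℕ.≤ s))
  ¬¬-maximum zero bd (m , q) ¬max =
    ¬max (m , q , λ k qk → ℕ.≤-trans (bd k qk) ℕ.z≤n)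
  ¬¬-maximum {Q} (suc B) bd ex ¬max = ¬¬-excluded-middle λ where
    (yes q) → ¬max (suc B , q , bd)
    (no ¬q) → ¬¬-maximum B
      (λ m qm → ℕ.s≤s⁻¹ (ℕ.≤∧≢⇒< (bd m qm) λ { refl → ¬q qm })) ex ¬max

-- Classically this is existence.  A bound on S△(n) is therefore a bound on
-- S△(P) for every P, since ≤ on numbers is stable under double negation.
S△-exists : ∀ n → ¬ ¬ (∃[ s ] S△ n ≡ s)
S△-exists n ¬ex =
  ¬¬-Π (λ i → ¬¬-Π λ j → ¬¬-Π λ k → ¬¬-excluded-middle) λ dec →
  let m , c = count (collinear n) (λ { (i , j , k) → dec i j k }) in
  ¬¬-maximum (n ℕ.* (n ℕ.* n)) (λ { _ (P , c′) → count-bounded P c′ })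
    (m , collinear n , c)
    λ { (s , att , max) → ¬ex (s , record
      { attained = att ; maximal = λ P k c′ → max k (P , c′) }) }

S△-unique : ∀ {n s s′} → S△ n ≡ s → S△ n ≡ s′ → s ≡ s′
S△-unique S S′ = ℕ.≤-antisym (bound S S′) (bound S′ S)
  where
  open S△_≡_
  bound : ∀ {n s s′} → S△ n ≡ s → S△ n ≡ s′ → s ℕ.≤ s′
  bound T T′ = let P , c = attained T in maximal T′ P _ c

{-# OPTIONS --safe #-}

-- For a point z let d(z) be the number of triangles with their right angle at
-- z and M(z) the number of triangles in which z is the middle vertex from left
-- to right, so that 3 S(P) = Σ (2 d(z) + M(z)). Let z have l points on its
-- left, r on its right, l ≤ r. A quarter turn about z matches right points in
-- disjoint pairs, at most r/2, each of a point above and a point below z; and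
-- each left point accounts for at most 5 of the rest of 2 d(z) + M(z): 3 for a
-- triangle with its right angle at z and the third vertex on the right, and 2
-- either for triangles with an acute angle at z that reach to the right, if
-- the point is near the vertical, or for a triangle on the left with its right
-- angle at z, otherwise. Hence 2 d(z) + M(z) ≤ 5 l + r, and the term r can be
-- replaced by 0 for the highest and lowest points and by 2 for the points next
-- to them. Summing over all z, with distinct values of l, gives the bound for
-- n ≥ 5; for n ≤ 4 it is at least the number of all triplets.
module Submission where

open import Defs
open import Data.Nat using (ℕ; zero; suc; z≤n; s≤s; _≥_)
import Data.Nat.Properties as ℕ
open import Data.Fin as Fin using (Fin; zero; suc; toℕ; fromℕ<)
import Data.Fin.Properties as Fin
open import Data.Product using (_×_; _,_; proj₁; proj₂; ∃-syntax)
open import Data.Sum using (_⊎_; inj₁; inj₂; [_,_]′)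
open import Data.Empty using (⊥; ⊥-elim)
open import Data.List using (List; length; lookup)
open import Data.List.Membership.Propositional using (_∈_)
open import Data.List.Membership.Propositional.Properties using (∈-lookup)
open import Data.List.Relation.Unary.Unique.Propositional using (Unique)
import Data.List.Relation.Unary.AllPairs as AllPairs
import Data.List.Relation.Unary.All as All
open import Effect.Monad using (RawMonad)
open import Function using (_∘_; Injective; flip; Equivalence)
open import Level using (0ℓ)
open import Algebra.Bundles using (AbelianGroup)
open import Relation.Nullary using (¬_; Dec; yes; no)
open import Relation.Nullary.Negation using (¬¬-Monad)
open import Relation.Nullary.Decidable
  using (_×-dec_; _⊎-dec_; ¬?; dec⇒maybe; ¬¬-excluded-middle; decidable-stable)
open import Relation.Binary using (Rel; Decidable; IsStrictTotalOrder; tri<; tri≈; tri>)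
open import Relation.Binary.PropositionalEquality as ≡
  using (_≡_; _≢_; refl; sym; trans; cong; cong₂; subst; subst₂; module ≡-Reasoning)

-- Summed over all z without refinement, 5 l + r = 4 l + (n - 1) gives 2 (n - 1)² plus n - 1 for odd
-- n and plus n - 2 for even n, so an excess of order n has to be saved. The two highest and the two
-- lowest points save about n / 2 each, roughly 2 n together; this covers the excess and the
-- constant 5 from n = 7 on, and for n = 5 and n = 6 integrality closes the gap. Ties in position
-- would spoil every exact count. The horizontal order is therefore lexicographic and the vertical
-- order is the same one turned by a right angle, so that all the geometry reduces to adding vectors
-- of one half-plane `H` that contains one of its bounding rays. Equality and order of these reals
-- are undecidable. The counting is therefore done for an abstract `Configuration` with decidable
-- relations, and the points yield one only up to double negation, which is enough for an inequality
-- between natural numbers.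

module Counting where
  open import Data.Nat using (_+_; _*_; _≤_; _<_)
  open import Data.Nat.Tactic.RingSolver using (solve-∀)
  open import Algebra.Properties.Semiring.Sum ℕ.+-*-semiring
    using (sum-syntax; ∑-comm; ∑-distrib-+; sum-cong-≗; *-distribˡ-sum)

  -- Indicators and sums over finite index sets.

  ⟦_⟧ : {P : Set} → Dec P → ℕ
  ⟦ yes _ ⟧ = 1
  ⟦ no  _ ⟧ = 0

  module _ {P : Set} where

    1≤⟦_⟧ : (P? : Dec P) → P → 1 ≤ ⟦ P? ⟧
    1≤⟦ yes _ ⟧ p = s≤s z≤n
    1≤⟦ no ¬p ⟧ p = ⊥-elim (¬p p)

    ⟦_⟧≤1 : (P? : Dec P) → ⟦ P? ⟧ ≤ 1
    ⟦ yes _ ⟧≤1 = s≤s z≤n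
    ⟦ no  _ ⟧≤1 = z≤n

    0<⟦⟧⇒ : (P? : Dec P) → 0 < ⟦ P? ⟧ → P
    0<⟦⟧⇒ (yes p) _ = p

    ⟦⟧*-mono : (P? : Dec P) → ∀ {x y} → (P → x ≤ y) → ⟦ P? ⟧ * x ≤ ⟦ P? ⟧ * y
    ⟦⟧*-mono (yes p) x≤y = ℕ.*-monoʳ-≤ 1 (x≤y p)
    ⟦⟧*-mono (no  _) _   = z≤n

    ⟦⟧*≤ : (P? : Dec P) → ∀ x → ⟦ P? ⟧ * x ≤ x
    ⟦⟧*≤ P? x = ℕ.≤-trans (ℕ.*-monoˡ-≤ x ⟦ P? ⟧≤1) (ℕ.≤-reflexive (ℕ.*-identityˡ x))

  ⟦⟧-mono : {P Q : Set} (P? : Dec P) (Q? : Dec Q) → (P → Q) → ⟦ P? ⟧ ≤ ⟦ Q? ⟧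
  ⟦⟧-mono (yes p) Q? P⇒Q = 1≤⟦ Q? ⟧ (P⇒Q p)
  ⟦⟧-mono (no  _) Q? P⇒Q = z≤n

  ⟦⟧+⟦⟧≤1 : {P Q : Set} (P? : Dec P) (Q? : Dec Q) → ¬ (P × Q) → ⟦ P? ⟧ + ⟦ Q? ⟧ ≤ 1
  ⟦⟧+⟦⟧≤1 (yes p) (yes q) ¬pq = ⊥-elim (¬pq (p , q))
  ⟦⟧+⟦⟧≤1 (yes _) (no  _) _   = s≤s z≤n
  ⟦⟧+⟦⟧≤1 (no  _) Q?      _   = ⟦ Q? ⟧≤1

  0<*⇒ : ∀ x y → 0 < x * y → 0 < x × 0 < y
  0<*⇒ (suc x) (suc y) _ = s≤s z≤n , s≤s z≤n
  0<*⇒ (suc x) zero    h = ⊥-elim (ℕ.<-irrefl (sym (ℕ.*-zeroʳ x)) h)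

  ∑-mono : ∀ {n} {f g : Fin n → ℕ} → (∀ i → f i ≤ g i) → ∑[ i < n ] f i ≤ ∑[ i < n ] g i
  ∑-mono {zero}  _   = z≤n
  ∑-mono {suc n} f≤g = ℕ.+-mono-≤ (f≤g zero) (∑-mono (f≤g ∘ suc))

  ∑-const : ∀ n c → ∑[ i < n ] c ≡ n * c
  ∑-const zero    c = refl
  ∑-const (suc n) c = cong (c +_) (∑-const n c)

  ≤-∑ : ∀ {n} (f : Fin n → ℕ) i → f i ≤ ∑[ j < n ] f j
  ≤-∑ f zero    = ℕ.m≤m+n (f zero) _
  ≤-∑ f (suc i) = ℕ.≤-trans (≤-∑ (f ∘ suc) i) (ℕ.m≤n+m _ (f zero))

  ∑-+-≤ : ∀ {n a b} (f g : Fin n → ℕ) → ∑[ i < n ] f i ≤ a → ∑[ i < n ] g i ≤ b →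
          ∑[ i < n ] (f i + g i) ≤ a + b
  ∑-+-≤ f g f≤a g≤b = ℕ.≤-trans (ℕ.≤-reflexive (∑-distrib-+ f g)) (ℕ.+-mono-≤ f≤a g≤b)

  ∑-*-≤ : ∀ {n a} c (f : Fin n → ℕ) → ∑[ i < n ] f i ≤ a → ∑[ i < n ] (c * f i) ≤ c * a
  ∑-*-≤ c f f≤a = ℕ.≤-trans (ℕ.≤-reflexive (sym (*-distribˡ-sum c f))) (ℕ.*-monoʳ-≤ c f≤a)

  ∑-subsingleton : ∀ {n c} (f : Fin n → ℕ) →
                   (∀ {i j} → 0 < f i → 0 < f j → i ≡ j) → (∀ i → f i ≤ c) →
                   ∑[ i < n ] f i ≤ c
  ∑-subsingleton {zero}  f uniq f≤c = z≤n
  ∑-subsingleton {suc n} {c} f uniq f≤c with f zero in eq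
  ... | zero  = ∑-subsingleton (f ∘ suc) (λ p q → Fin.suc-injective (uniq p q)) (f≤c ∘ suc)
  ... | suc k = begin
    suc k + ∑[ i < n ] f (suc i)  ≤⟨ ℕ.+-monoʳ-≤ (suc k) (∑-mono vanish) ⟩
    suc k + ∑[ i < n ] 0          ≡⟨ cong (suc k +_) (trans (∑-const n 0) (ℕ.*-zeroʳ n)) ⟩
    suc k + 0                     ≡⟨ ℕ.+-identityʳ (suc k) ⟩
    suc k                         ≡⟨ eq ⟨
    f zero                        ≤⟨ f≤c zero ⟩
    c                             ∎
    where
    open ℕ.≤-Reasoning
    0<f₀ : 0 < f zero
    0<f₀ = subst (0 <_) (sym eq) (s≤s z≤n)
    vanish : ∀ i → f (suc i) ≤ 0
    vanish i = ℕ.≮⇒≥ λ 0<fᵢ → Fin.0≢1+n (uniq 0<f₀ 0<fᵢ)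

  -- In the applications `c` is built from indicators, such as `up p`: uniqueness leaves at most one
  -- term, and the presence of that term forces the condition that `c` indicates. This is how a
  -- quarter turn and its effect on sides enter the count.
  ∑⟦⟧*⟦⟧≤ : ∀ {n c} {P Q : Fin n → Set} (P? : ∀ i → Dec (P i)) (Q? : ∀ i → Dec (Q i)) →
            (∀ {i j} → Q i → Q j → i ≡ j) → (∀ {i} → P i → Q i → 1 ≤ c) →
            ∑[ i < n ] (⟦ P? i ⟧ * ⟦ Q? i ⟧) ≤ c
  ∑⟦⟧*⟦⟧≤ {c = c} P? Q? uniq 1≤c = ∑-subsingleton _
    (λ {i} {j} p q → uniq (0<⟦⟧⇒ (Q? i) (proj₂ (0<*⇒ ⟦ P? i ⟧ _ p)))
                          (0<⟦⟧⇒ (Q? j) (proj₂ (0<*⇒ ⟦ P? j ⟧ _ q))))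
    bound
    where
    bound : ∀ i → ⟦ P? i ⟧ * ⟦ Q? i ⟧ ≤ c
    bound i with P? i | Q? i
    ... | yes p | yes q = 1≤c p q
    ... | yes _ | no  _ = z≤n
    ... | no  _ | _     = z≤n

  ∑⟦≡⟧ : ∀ {n} (i : Fin n) → ∑[ j < n ] ⟦ j Fin.≟ i ⟧ ≡ 1
  ∑⟦≡⟧ i = ℕ.≤-antisym
    (∑-subsingleton _ (λ {j} {k} p q → trans (0<⟦⟧⇒ (j Fin.≟ i) p) (sym (0<⟦⟧⇒ (k Fin.≟ i) q)))
                      (λ j → ⟦ j Fin.≟ i ⟧≤1))
    (ℕ.≤-trans (1≤⟦ i Fin.≟ i ⟧ refl) (≤-∑ (λ j → ⟦ j Fin.≟ i ⟧) i))

  -- Double counting of the pairs with `e i ≡ j`: every i has one, every j at most one.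
  ∑-injective-≤ : ∀ {m n} {e : Fin m → Fin n} → Injective _≡_ _≡_ e → (f : Fin n → ℕ) →
                  ∑[ i < m ] f (e i) ≤ ∑[ j < n ] f j
  ∑-injective-≤ {m} {n} {e} inj f = begin
    ∑[ i < m ] f (e i)                                  ≤⟨ ∑-mono (λ i → single i) ⟩
    ∑[ i < m ] ∑[ j < n ] (⟦ e i Fin.≟ j ⟧ * f j)       ≡⟨ ∑-comm (λ i j → ⟦ e i Fin.≟ j ⟧ * f j) ⟩
    ∑[ j < n ] ∑[ i < m ] (⟦ e i Fin.≟ j ⟧ * f j)       ≤⟨ ∑-mono (λ j → ∑-subsingleton _
                                                             (λ p q → inj (trans (hit p) (sym (hit q))))
                                                             (λ i → ⟦⟧*≤ (e i Fin.≟ j) (f j))) ⟩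
    ∑[ j < n ] f j                                      ∎
    where
    open ℕ.≤-Reasoning
    hit : ∀ {i j} → 0 < ⟦ e i Fin.≟ j ⟧ * f j → e i ≡ j
    hit {i} {j} p = 0<⟦⟧⇒ (e i Fin.≟ j) (proj₁ (0<*⇒ ⟦ e i Fin.≟ j ⟧ (f j) p))
    single : ∀ i → f (e i) ≤ ∑[ j < n ] (⟦ e i Fin.≟ j ⟧ * f j)
    single i = begin
      f (e i)                              ≡⟨ ℕ.*-identityˡ _ ⟨
      1 * f (e i)                          ≤⟨ ℕ.*-monoˡ-≤ (f (e i)) (1≤⟦ e i Fin.≟ e i ⟧ refl) ⟩
      ⟦ e i Fin.≟ e i ⟧ * f (e i)          ≤⟨ ≤-∑ (λ j → ⟦ e i Fin.≟ j ⟧ * f j) (e i) ⟩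
      ∑[ j < n ] (⟦ e i Fin.≟ j ⟧ * f j)   ∎

  -- Ranks in a finite linear order.

  module Rank {n} {_≺_ : Rel (Fin n) 0ℓ} (isStrictTotalOrder : IsStrictTotalOrder _≡_ _≺_)
              (_<?_ : Decidable _≺_) where
    open IsStrictTotalOrder isStrictTotalOrder using (compare; irrefl; asym) renaming (trans to ≺-trans)

    rank corank : Fin n → ℕ
    rank   i = ∑[ j < n ] ⟦ j <? i ⟧
    corank i = ∑[ j < n ] ⟦ i <? j ⟧

    rank-mono : ∀ {i j} → i ≺ j → rank i < rank j
    rank-mono {i} {j} i≺j = begin
      suc (rank i)                                  ≡⟨ ℕ.+-comm (rank i) 1 ⟨
      rank i + 1                                    ≡⟨ cong (rank i +_) (∑⟦≡⟧ i) ⟨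
      rank i + ∑[ k < n ] ⟦ k Fin.≟ i ⟧             ≡⟨ ∑-distrib-+ (λ k → ⟦ k <? i ⟧) (λ k → ⟦ k Fin.≟ i ⟧) ⟨
      ∑[ k < n ] (⟦ k <? i ⟧ + ⟦ k Fin.≟ i ⟧)       ≤⟨ ∑-mono pointwise ⟩
      rank j                                        ∎
      where
      open ℕ.≤-Reasoning
      pointwise : ∀ k → ⟦ k <? i ⟧ + ⟦ k Fin.≟ i ⟧ ≤ ⟦ k <? j ⟧
      pointwise k with k <? i | k Fin.≟ i
      ... | yes k≺i | yes refl = ⊥-elim (irrefl refl k≺i)
      ... | yes k≺i | no  _    = 1≤⟦ k <? j ⟧ (≺-trans k≺i i≺j)
      ... | no  _   | yes refl = 1≤⟦ k <? j ⟧ i≺j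
      ... | no  _   | no  _    = z≤n

    rank-injective : Injective _≡_ _≡_ rank
    rank-injective {i} {j} eq with compare i j
    ... | tri< i≺j _ _   = ⊥-elim (ℕ.<-irrefl eq (rank-mono i≺j))
    ... | tri≈ _ i≡j _   = i≡j
    ... | tri> _ _ j≺i   = ⊥-elim (ℕ.<-irrefl (sym eq) (rank-mono j≺i))

    rank+corank : ∀ i → suc (rank i + corank i) ≡ n
    rank+corank i = begin
      suc (rank i + corank i)                                           ≡⟨ ℕ.+-comm 1 _ ⟩
      rank i + corank i + 1                                             ≡⟨ cong₂ _+_ (∑-distrib-+ (λ k → ⟦ k <? i ⟧) (λ k → ⟦ i <? k ⟧)) (∑⟦≡⟧ i) ⟨
      ∑[ k < n ] (⟦ k <? i ⟧ + ⟦ i <? k ⟧) + ∑[ k < n ] ⟦ k Fin.≟ i ⟧   ≡⟨ ∑-distrib-+ (λ k → ⟦ k <? i ⟧ + ⟦ i <? k ⟧) (λ k → ⟦ k Fin.≟ i ⟧) ⟨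
      ∑[ k < n ] (⟦ k <? i ⟧ + ⟦ i <? k ⟧ + ⟦ k Fin.≟ i ⟧)              ≡⟨ sum-cong-≗ pointwise ⟩
      ∑[ k < n ] 1                                                      ≡⟨ ∑-const n 1 ⟩
      n * 1                                                             ≡⟨ ℕ.*-identityʳ n ⟩
      n                                                                 ∎
      where
      open ≡-Reasoning
      pointwise : ∀ k → ⟦ k <? i ⟧ + ⟦ i <? k ⟧ + ⟦ k Fin.≟ i ⟧ ≡ 1
      pointwise k with k <? i | i <? k | k Fin.≟ i
      ... | yes p | yes q | _        = ⊥-elim (asym p q)
      ... | yes p | no  _ | yes k≡i  = ⊥-elim (irrefl k≡i p)
      ... | yes _ | no  _ | no _     = refl
      ... | no _  | yes q | yes k≡i  = ⊥-elim (irrefl (sym k≡i) q)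
      ... | no _  | yes _ | no _     = refl
      ... | no _  | no _  | yes _    = refl
      ... | no p  | no q  | no k≢i with compare k i
      ...   | tri< a _ _ = ⊥-elim (p a)
      ...   | tri≈ _ b _ = ⊥-elim (k≢i b)
      ...   | tri> _ _ c = ⊥-elim (q c)

  -- Sums over ordered and over increasing triples.

  ∑³ : ∀ {n} → (Fin n → Fin n → Fin n → ℕ) → ℕ
  ∑³ {n} f = ∑[ i < n ] ∑[ j < n ] ∑[ k < n ] f i j k

  ∑³-mono : ∀ {n} {f g : Fin n → Fin n → Fin n → ℕ} → (∀ i j k → f i j k ≤ g i j k) → ∑³ f ≤ ∑³ g
  ∑³-mono f≤g = ∑-mono λ i → ∑-mono λ j → ∑-mono λ k → f≤g i j k

  ∑³-cong : ∀ {n} {f g : Fin n → Fin n → Fin n → ℕ} → (∀ i j k → f i j k ≡ g i j k) → ∑³ f ≡ ∑³ g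
  ∑³-cong f≡g = sum-cong-≗ λ i → sum-cong-≗ λ j → sum-cong-≗ λ k → f≡g i j k

  ∑³-+ : ∀ {n} (f g : Fin n → Fin n → Fin n → ℕ) → ∑³ (λ i j k → f i j k + g i j k) ≡ ∑³ f + ∑³ g
  ∑³-+ {n} f g = trans
    (sum-cong-≗ λ i → trans (sum-cong-≗ λ j → ∑-distrib-+ (f i j) (g i j))
                            (∑-distrib-+ (λ j → ∑[ k < n ] f i j k) (λ j → ∑[ k < n ] g i j k)))
    (∑-distrib-+ (λ i → ∑[ j < n ] ∑[ k < n ] f i j k) (λ i → ∑[ j < n ] ∑[ k < n ] g i j k))

  ∑³-swapˡ : ∀ {n} (f : Fin n → Fin n → Fin n → ℕ) → ∑³ f ≡ ∑³ (λ i j k → f j i k)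
  ∑³-swapˡ {n} f = ∑-comm (λ i j → ∑[ k < n ] f i j k)

  ∑³-swapʳ : ∀ {n} (f : Fin n → Fin n → Fin n → ℕ) → ∑³ f ≡ ∑³ (λ i j k → f i k j)
  ∑³-swapʳ f = sum-cong-≗ λ i → ∑-comm (f i)

  injective⇒≤∑³ : ∀ {m n} {e : Fin m → Triple n} → Injective _≡_ _≡_ e →
                  (w : Fin n → Fin n → Fin n → ℕ) →
                  (∀ x → 1 ≤ w (proj₁ (e x)) (proj₁ (proj₂ (e x))) (proj₂ (proj₂ (e x)))) →
                  m ≤ ∑³ w
  injective⇒≤∑³ {m} {n} {e} inj w 1≤w = begin
    m                                                ≡⟨ trans (∑-const m 1) (ℕ.*-identityʳ m) ⟨
    ∑[ x < m ] 1                                     ≤⟨ ∑-mono single ⟩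
    ∑[ x < m ] ∑³ (λ i j k → hit x i j k * w i j k)  ≡⟨ swap (λ x i j k → hit x i j k * w i j k) ⟩
    ∑³ (λ i j k → ∑[ x < m ] (hit x i j k * w i j k)) ≤⟨ ∑³-mono (λ i j k → ∑-subsingleton _
                                                          (λ {x} {y} p q → inj (trans (found x p) (sym (found y q))))
                                                          (λ x → ⟦⟧*≤ (hit? x i j k) (w i j k))) ⟩
    ∑³ w                                             ∎
    where
    open ℕ.≤-Reasoning
    a b c : Fin m → Fin n
    a x = proj₁ (e x)
    b x = proj₁ (proj₂ (e x))
    c x = proj₂ (proj₂ (e x))
    hit? : ∀ x i j k → Dec (a x ≡ i × b x ≡ j × c x ≡ k)
    hit? x i j k = (a x Fin.≟ i) ×-dec (b x Fin.≟ j) ×-dec (c x Fin.≟ k)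
    hit : Fin m → Fin n → Fin n → Fin n → ℕ
    hit x i j k = ⟦ hit? x i j k ⟧
    found : ∀ x {i j k} → 0 < hit x i j k * w i j k → e x ≡ (i , j , k)
    found x {i} {j} {k} p with refl , refl , refl ← 0<⟦⟧⇒ (hit? x i j k) (proj₁ (0<*⇒ (hit x i j k) (w i j k) p)) = refl
    swap : (f : Fin m → Fin n → Fin n → Fin n → ℕ) → ∑[ x < m ] ∑³ (f x) ≡ ∑³ (λ i j k → ∑[ x < m ] f x i j k)
    swap f = trans (∑-comm (λ x i → ∑[ j < n ] ∑[ k < n ] f x i j k))
      (sum-cong-≗ λ i → trans (∑-comm (λ x j → ∑[ k < n ] f x i j k))
        (sum-cong-≗ λ j → ∑-comm (λ x k → f x i j k)))
    single : ∀ x → 1 ≤ ∑³ (λ i j k → hit x i j k * w i j k)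
    single x = begin
      1                                                   ≤⟨ ℕ.*-mono-≤ (1≤⟦ hit? x (a x) (b x) (c x) ⟧ (refl , refl , refl)) (1≤w x) ⟩
      hit x (a x) (b x) (c x) * w (a x) (b x) (c x)       ≤⟨ ≤-∑ (λ k → hit x (a x) (b x) k * w (a x) (b x) k) (c x) ⟩
      ∑[ k < n ] (hit x (a x) (b x) k * w (a x) (b x) k)  ≤⟨ ≤-∑ (λ j → ∑[ k < n ] (hit x (a x) j k * w (a x) j k)) (b x) ⟩
      ∑[ j < n ] ∑[ k < n ] (hit x (a x) j k * w (a x) j k) ≤⟨ ≤-∑ (λ i → ∑[ j < n ] ∑[ k < n ] (hit x i j k * w i j k)) (a x) ⟩
      ∑³ (λ i j k → hit x i j k * w i j k)                ∎

  lookup-injective : ∀ {A : Set} {xs : List A} → Unique xs → Injective _≡_ _≡_ (lookup xs)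
  lookup-injective (_  AllPairs.∷ _) {zero}  {zero}  _  = refl
  lookup-injective (x∉ AllPairs.∷ _) {zero}  {suc j} eq = ⊥-elim (All.lookup x∉ (∈-lookup j) eq)
  lookup-injective (x∉ AllPairs.∷ _) {suc i} {zero}  eq = ⊥-elim (All.lookup x∉ (∈-lookup i) (sym eq))
  lookup-injective (_  AllPairs.∷ u) {suc i} {suc j} eq = cong suc (lookup-injective u eq)

  length≤∑³ : ∀ {n} {ts : List (Triple n)} → Unique ts → (w : Fin n → Fin n → Fin n → ℕ) →
              (∀ {i j k} → (i , j , k) ∈ ts → 1 ≤ w i j k) → length ts ≤ ∑³ w
  length≤∑³ {ts = ts} uniq w 1≤w = injective⇒≤∑³ {e = lookup ts} (lookup-injective uniq) w λ x → 1≤w (∈-lookup {xs = ts} x)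

  increasing : ∀ {n} → Fin n → Fin n → Fin n → ℕ
  increasing i j k = ⟦ i Fin.<? j ⟧ * ⟦ j Fin.<? k ⟧

  -- This passes from triplets listed in increasing order to quarter turns, whose three arguments
  -- have fixed roles. Renaming the variables in each of the six sums puts `f i j k` into all of
  -- them, and at most one of the six orders of i, j, k is increasing.
  ∑³-increasing : ∀ {n} (f : Fin n → Fin n → Fin n → ℕ) →
    ∑³ (λ i j k → increasing i j k * (f i j k + f i k j + f j i k + f j k i + f k i j + f k j i)) ≤ ∑³ f
  ∑³-increasing {n} f = begin
    ∑³ (λ i j k → I i j k * (f i j k + f i k j + f j i k + f j k i + f k i j + f k j i))
      ≡⟨ ∑³-cong (λ i j k → distribute (I i j k) (f i j k) (f i k j) (f j i k) (f j k i) (f k i j) (f k j i)) ⟩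
    ∑³ (λ i j k → g₁ i j k + g₂ i j k + g₃ i j k + g₄ i j k + g₅ i j k + g₆ i j k)
      ≡⟨ sum₆ g₁ g₂ g₃ g₄ g₅ g₆ ⟩
    ∑³ g₁ + ∑³ g₂ + ∑³ g₃ + ∑³ g₄ + ∑³ g₅ + ∑³ g₆
      ≡⟨ cong₂ _+_ (cong₂ _+_ (cong₂ _+_ (cong₂ _+_ (cong (∑³ g₁ +_)
           (∑³-swapʳ g₂)) (∑³-swapˡ g₃))
           (trans (∑³-swapˡ g₄) (∑³-swapʳ (λ i j k → g₄ j i k))))
           (trans (∑³-swapʳ g₅) (∑³-swapˡ (λ i j k → g₅ i k j))))
           (trans (∑³-swapʳ g₆) (trans (∑³-swapˡ (λ i j k → g₆ i k j)) (∑³-swapʳ (λ i j k → g₆ j k i)))) ⟩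
    ∑³ h₁ + ∑³ h₂ + ∑³ h₃ + ∑³ h₄ + ∑³ h₅ + ∑³ h₆
      ≡⟨ sum₆ h₁ h₂ h₃ h₄ h₅ h₆ ⟨
    ∑³ (λ i j k → h₁ i j k + h₂ i j k + h₃ i j k + h₄ i j k + h₅ i j k + h₆ i j k)
      ≤⟨ ∑³-mono pointwise ⟩
    ∑³ f ∎
    where
    open ℕ.≤-Reasoning
    I = increasing {n}
    g₁ g₂ g₃ g₄ g₅ g₆ h₁ h₂ h₃ h₄ h₅ h₆ : Fin n → Fin n → Fin n → ℕ
    g₁ i j k = I i j k * f i j k
    g₂ i j k = I i j k * f i k j
    g₃ i j k = I i j k * f j i k
    g₄ i j k = I i j k * f j k i
    g₅ i j k = I i j k * f k i j
    g₆ i j k = I i j k * f k j i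
    h₁ i j k = I i j k * f i j k
    h₂ i j k = I i k j * f i j k
    h₃ i j k = I j i k * f i j k
    h₄ i j k = I k i j * f i j k
    h₅ i j k = I j k i * f i j k
    h₆ i j k = I k j i * f i j k
    distribute : ∀ c x₁ x₂ x₃ x₄ x₅ x₆ → c * (x₁ + x₂ + x₃ + x₄ + x₅ + x₆) ≡
                 c * x₁ + c * x₂ + c * x₃ + c * x₄ + c * x₅ + c * x₆
    distribute = solve-∀
    collect : ∀ x c₁ c₂ c₃ c₄ c₅ c₆ → c₁ * x + c₂ * x + c₃ * x + c₄ * x + c₅ * x + c₆ * x ≡
              (c₁ + c₂ + c₃ + c₄ + c₅ + c₆) * x
    collect = solve-∀
    sum₆ : ∀ a b c d e g → ∑³ (λ i j k → a i j k + b i j k + c i j k + d i j k + e i j k + g i j k) ≡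
           ∑³ a + ∑³ b + ∑³ c + ∑³ d + ∑³ e + ∑³ g
    sum₆ a b c d e g =
      trans (∑³-+ (λ i j k → a i j k + b i j k + c i j k + d i j k + e i j k) g) (cong (_+ ∑³ g)
      (trans (∑³-+ (λ i j k → a i j k + b i j k + c i j k + d i j k) e) (cong (_+ ∑³ e)
      (trans (∑³-+ (λ i j k → a i j k + b i j k + c i j k) d) (cong (_+ ∑³ d)
      (trans (∑³-+ (λ i j k → a i j k + b i j k) c) (cong (_+ ∑³ c) (∑³-+ a b))))))))
    -- Weakening j < i to the negation of i < j expresses all six orders through only three
    -- decisions; the sum stays at most 1 even so.
    converse : ∀ (i j : Fin n) → ⟦ j Fin.<? i ⟧ ≤ ⟦ ¬? (i Fin.<? j) ⟧
    converse i j = ⟦⟧-mono (j Fin.<? i) (¬? (i Fin.<? j)) λ j<i i<j → Fin.<-asym i<j j<i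
    orders : ∀ i j k → I i j k + I i k j + I j i k + I k i j + I j k i + I k j i ≤ 1
    orders i j k = ℕ.≤-trans
      (ℕ.+-mono-≤ (ℕ.+-mono-≤ (ℕ.+-mono-≤ (ℕ.+-mono-≤ (ℕ.+-mono-≤
        (ℕ.≤-refl {I i j k})
        (ℕ.*-monoʳ-≤ ⟦ i Fin.<? k ⟧ (converse j k)))
        (ℕ.*-monoˡ-≤ ⟦ i Fin.<? k ⟧ (converse i j)))
        (ℕ.*-monoˡ-≤ ⟦ i Fin.<? j ⟧ (converse i k)))
        (ℕ.*-monoʳ-≤ ⟦ j Fin.<? k ⟧ (converse i k)))
        (ℕ.*-mono-≤ (converse j k) (converse i j)))
      (cases (i Fin.<? j) (j Fin.<? k) (i Fin.<? k))
      where
      cases : (p : Dec (i Fin.< j)) (q : Dec (j Fin.< k)) (r : Dec (i Fin.< k)) →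
        ⟦ p ⟧ * ⟦ q ⟧ + ⟦ r ⟧ * ⟦ ¬? q ⟧ + ⟦ ¬? p ⟧ * ⟦ r ⟧ + ⟦ ¬? r ⟧ * ⟦ p ⟧ + ⟦ q ⟧ * ⟦ ¬? r ⟧ + ⟦ ¬? q ⟧ * ⟦ ¬? p ⟧ ≤ 1
      cases (yes i<j) (yes j<k) (no i≮k)  = ⊥-elim (i≮k (Fin.<-trans i<j j<k))
      cases (no i≮j)  (no j≮k)  (yes i<k) = ⊥-elim (ℕ.<⇒≱ i<k (ℕ.≤-trans (ℕ.≮⇒≥ j≮k) (ℕ.≮⇒≥ i≮j)))
      cases (yes _)   (yes _)   (yes _)   = ℕ.≤-refl
      cases (yes _)   (no _)    (yes _)   = ℕ.≤-refl
      cases (yes _)   (no _)    (no _)    = ℕ.≤-refl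
      cases (no _)    (yes _)   (yes _)   = ℕ.≤-refl
      cases (no _)    (yes _)   (no _)    = ℕ.≤-refl
      cases (no _)    (no _)    (no _)    = ℕ.≤-refl
    pointwise : ∀ i j k → h₁ i j k + h₂ i j k + h₃ i j k + h₄ i j k + h₅ i j k + h₆ i j k ≤ f i j k
    pointwise i j k = begin
      h₁ i j k + h₂ i j k + h₃ i j k + h₄ i j k + h₅ i j k + h₆ i j k
        ≡⟨ collect (f i j k) (I i j k) (I i k j) (I j i k) (I k i j) (I j k i) (I k j i) ⟩
      (I i j k + I i k j + I j i k + I k i j + I j k i + I k j i) * f i j k
        ≤⟨ ℕ.*-monoˡ-≤ (f i j k) (orders i j k) ⟩
      1 * f i j k
        ≡⟨ ℕ.*-identityˡ (f i j k) ⟩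
      f i j k ∎

open Counting

-- Finite configurations with two linear orders and quarter turns.

module Rotations where
  open import Data.Nat using (_+_; _*_; _∸_; _⊓_; _≤_; _<_; _≟_; ⌊_/2⌋)
  open import Data.Nat.Tactic.RingSolver using (solve-∀)
  open import Algebra.Properties.Semiring.Sum ℕ.+-*-semiring
    using (sum-syntax; ∑-comm; ∑-distrib-+; sum-cong-≗; *-distribˡ-sum; sum-init-last)
  import Relation.Binary.Construct.Flip.EqAndOrd as Flip

  -- In the intended model z ≺ p says that p lies to the right of z, z ≺′ p that
  -- p lies above z, Rotated z p q that a counterclockwise quarter turn about z
  -- takes p to q, and Near z p, for p to the left of z, that zp makes an angle
  -- less than 45° with the vertical.
  record Sided {n} (_≺_ _≺′_ : Rel (Fin n) 0ℓ) (Rotated : Fin n → Fin n → Fin n → Set) : Set₁ where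
    field
      Near  : Rel (Fin n) 0ℓ
      near? : Decidable Near

      rotate-≻ˡ : ∀ {z p q} → Rotated z p q → z ≺ p → z ≺′ q
      rotate-≻ʳ : ∀ {z p q} → Rotated z p q → z ≺ q → p ≺′ z
      rotate-≺ˡ : ∀ {z p q} → Rotated z p q → p ≺ z → q ≺′ z
      rotate-≺ʳ : ∀ {z p q} → Rotated z p q → q ≺ z → z ≺′ p

      cross-pzq : ∀ {z p q} → Rotated p z q → p ≺ z → z ≺ q → Near z p × z ≺′ p
      cross-qpz : ∀ {z p q} → Rotated q p z → p ≺ z → z ≺ q → Near z p × z ≺′ p
      cross-pqz : ∀ {z p q} → Rotated p q z → p ≺ z → z ≺ q → Near z p × p ≺′ z
      cross-qzp : ∀ {z p q} → Rotated q z p → p ≺ z → z ≺ q → Near z p × p ≺′ z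

      ¬both-near : ∀ {z p q} → Rotated z p q → p ≺ z → q ≺ z → Near z p → ¬ Near z q

  record Configuration (n : ℕ) : Set₁ where
    infix 4 _≺_ _≺′_ _≺?_ _≺′?_
    field
      _≺_ _≺′_ : Rel (Fin n) 0ℓ
      Rotated  : Fin n → Fin n → Fin n → Set
      _≺?_     : Decidable _≺_
      _≺′?_    : Decidable _≺′_
      rotated? : ∀ z p q → Dec (Rotated z p q)
      ≺-isStrictTotalOrder  : IsStrictTotalOrder _≡_ _≺_
      ≺′-isStrictTotalOrder : IsStrictTotalOrder _≡_ _≺′_

      distinct₁₂ : ∀ {z p q} → Rotated z p q → z ≢ p
      distinct₁₃ : ∀ {z p q} → Rotated z p q → z ≢ q
      distinct₂₃ : ∀ {z p q} → Rotated z p q → p ≢ q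
      unique₁ : ∀ {z z′ p q} → Rotated z p q → Rotated z′ p q → z ≡ z′
      unique₂ : ∀ {z p p′ q} → Rotated z p q → Rotated z p′ q → p ≡ p′
      unique₃ : ∀ {z p q q′} → Rotated z p q → Rotated z p q′ → q ≡ q′

      sided    : Sided _≺_ _≺′_ Rotated
      mirrored : Sided (flip _≺_) (flip _≺′_) Rotated

  -- A half turn of the plane reverses both orders and commutes with quarter turns, so `Rotated` is
  -- kept. This reduces the case of fewer points on the right to that of fewer points on the left.
  mirror : ∀ {n} → Configuration n → Configuration n
  mirror C = record
    { Configuration C
    ; _≺_   = flip _≺_
    ; _≺′_  = flip _≺′_
    ; _≺?_  = flip _≺?_
    ; _≺′?_ = flip _≺′?_
    ; ≺-isStrictTotalOrder  = Flip.isStrictTotalOrder ≺-isStrictTotalOrder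
    ; ≺′-isStrictTotalOrder = Flip.isStrictTotalOrder ≺′-isStrictTotalOrder
    ; sided    = mirrored
    ; mirrored = sided
    }
    where open Configuration C

  -- The bound at a single point.

  module LocalBound {n} (C : Configuration n) (z : Fin n) where
    open Configuration C
    open Sided sided
    open IsStrictTotalOrder ≺-isStrictTotalOrder using (compare; irrefl; asym)
    open IsStrictTotalOrder ≺′-isStrictTotalOrder using () renaming (asym to asym′)

    rot : Fin n → Fin n → Fin n → ℕ
    rot a b c = ⟦ rotated? a b c ⟧

    isLeft isRight up down near far : Fin n → ℕ
    isLeft  p = ⟦ p ≺? z ⟧
    isRight p = ⟦ z ≺? p ⟧
    up    p = ⟦ z ≺′? p ⟧
    down  p = ⟦ p ≺′? z ⟧
    near  p = ⟦ near? z p ⟧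
    far   p with near? z p
    ... | yes _ = 0
    ... | no  _ = 1

    opposite : Fin n → Fin n → ℕ
    opposite p q = isLeft p * isRight q + isRight p * isLeft q

    -- The quantity 2 d(z) + M(z): `opposite p q` is 1 exactly when z is the middle vertex, and a
    -- triangle whose right angle is not at z has z as the second or the third argument of
    -- `Rotated`.
    degree : ℕ
    degree = ∑[ p < n ] ∑[ q < n ]
      (rot z p q * (2 + opposite p q) + (rot p z q + rot p q z) * opposite p q)

    near+far : ∀ p → near p + far p ≡ 1
    near+far p with near? z p
    ... | yes _ = refl
    ... | no  _ = refl

    up+down≤1 : ∀ p → down p + up p ≤ 1
    up+down≤1 p = ⟦⟧+⟦⟧≤1 (p ≺′? z) (z ≺′? p) λ (p≺z , z≺p) → asym′ p≺z z≺p

    side : ∀ {p} → z ≢ p → (isLeft p ≡ 1 × isRight p ≡ 0) ⊎ (isLeft p ≡ 0 × isRight p ≡ 1)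
    side {p} z≢p with p ≺? z | z ≺? p
    ... | yes p≺z | yes z≺p = ⊥-elim (asym p≺z z≺p)
    ... | yes _   | no  _   = inj₁ (refl , refl)
    ... | no  _   | yes _   = inj₂ (refl , refl)
    ... | no  p⊀z | no  z⊀p with compare z p
    ...   | tri< z≺p _ _ = ⊥-elim (z⊀p z≺p)
    ...   | tri≈ _ z≡p _ = ⊥-elim (z≢p z≡p)
    ...   | tri> _ _ p≺z = ⊥-elim (p⊀z p≺z)

    far+far : ∀ {p q} → Rotated z p q → p ≺ z → q ≺ z → 1 ≤ far p + far q
    far+far {p} {q} r p≺z q≺z with near? z p | near? z q
    ... | yes np | yes nq = ⊥-elim (¬both-near r p≺z q≺z np nq)
    ... | yes _  | no  _  = s≤s z≤n
    ... | no  _  | _      = s≤s z≤n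

    rightwards : Fin n → ℕ
    rightwards p = ∑[ q < n ] (isRight q * rot z p q) + ∑[ q < n ] (isRight q * rot z q p)

    -- The charge to a left point p standing first in the pair of other vertices; in `leftwards′` it
    -- stands second. A triangle with right angle at z and both other vertices on the left weighs 2,
    -- and this is charged to each of them that is far. By `¬both-near` at least one is.
    leftwards : Fin n → Fin n → ℕ
    leftwards p q =
      3 * (isRight q * rot z p q) + (isRight q * rot p z q + isRight q * rot p q z)
        + 2 * far p * (isLeft q * rot z p q)

    leftwards′ : Fin n → Fin n → ℕ
    leftwards′ p q =
      3 * (isRight q * rot z q p) + (isRight q * rot q z p + isRight q * rot q p z)
        + 2 * far p * (isLeft q * rot z q p)

    Σrotʳ : ∀ p → ∑[ q < n ] (isRight q * rot z p q) ≤ down p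
    Σrotʳ p = ∑⟦⟧*⟦⟧≤ (z ≺?_) (rotated? z p) unique₃ λ z≺q r → 1≤⟦ p ≺′? z ⟧ (rotate-≻ʳ r z≺q)

    Σrotʳ′ : ∀ p → ∑[ q < n ] (isRight q * rot z q p) ≤ up p
    Σrotʳ′ p = ∑⟦⟧*⟦⟧≤ (z ≺?_) (λ q → rotated? z q p) unique₂ λ z≺q r → 1≤⟦ z ≺′? p ⟧ (rotate-≻ˡ r z≺q)

    Σrotˡ : ∀ p → ∑[ q < n ] (isLeft q * rot z p q) ≤ up p
    Σrotˡ p = ∑⟦⟧*⟦⟧≤ (_≺? z) (rotated? z p) unique₃ λ q≺z r → 1≤⟦ z ≺′? p ⟧ (rotate-≺ʳ r q≺z)

    Σrotˡ′ : ∀ p → ∑[ q < n ] (isLeft q * rot z q p) ≤ down p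
    Σrotˡ′ p = ∑⟦⟧*⟦⟧≤ (_≺? z) (λ q → rotated? z q p) unique₂ λ q≺z r → 1≤⟦ p ≺′? z ⟧ (rotate-≺ˡ r q≺z)

    near×up : ∀ {p} → Near z p × z ≺′ p → 1 ≤ near p * up p
    near×up {p} (np , z≺p) = ℕ.*-mono-≤ (1≤⟦ near? z p ⟧ np) (1≤⟦ z ≺′? p ⟧ z≺p)

    near×down : ∀ {p} → Near z p × p ≺′ z → 1 ≤ near p * down p
    near×down {p} (np , p≺z) = ℕ.*-mono-≤ (1≤⟦ near? z p ⟧ np) (1≤⟦ p ≺′? z ⟧ p≺z)

    -- Each of the eight sums has at most one nonzero term, and such a term fixes whether p is above
    -- or below z. As p cannot be both, the four sums for above and the four for below are never
    -- paid together, and near and far exclude each other in the same way; hence the product form.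
    Σleftwards : ∀ {p} → p ≺ z → ∑[ q < n ] (leftwards p q + leftwards′ p q) ≤ 5
    Σleftwards {p} p≺z = begin
      ∑[ q < n ] (leftwards p q + leftwards′ p q)
        ≤⟨ ∑-+-≤ (leftwards p) (leftwards′ p)
            (∑-+-≤ {n} _ _ (∑-+-≤ {n} _ _ (∑-*-≤ {n} 3 _ (Σrotʳ p))
              (∑-+-≤ {n} _ _
                (∑⟦⟧*⟦⟧≤ (z ≺?_) (rotated? p z) unique₃ λ z≺q r → near×up (cross-pzq r p≺z z≺q))
                (∑⟦⟧*⟦⟧≤ (z ≺?_) (λ q → rotated? p q z) unique₂ λ z≺q r → near×down (cross-pqz r p≺z z≺q))))
              (∑-*-≤ {n} (2 * far p) _ (Σrotˡ p)))
            (∑-+-≤ {n} _ _ (∑-+-≤ {n} _ _ (∑-*-≤ {n} 3 _ (Σrotʳ′ p))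
              (∑-+-≤ {n} _ _
                (∑⟦⟧*⟦⟧≤ (z ≺?_) (λ q → rotated? q z p) unique₁ λ z≺q r → near×down (cross-qzp r p≺z z≺q))
                (∑⟦⟧*⟦⟧≤ (z ≺?_) (λ q → rotated? q p z) unique₁ λ z≺q r → near×up (cross-qpz r p≺z z≺q))))
              (∑-*-≤ {n} (2 * far p) _ (Σrotˡ′ p))) ⟩
      (3 * down p + (near p * up p + near p * down p) + 2 * far p * up p)
        + (3 * up p + (near p * down p + near p * up p) + 2 * far p * down p)
        ≡⟨ collect (down p) (up p) (near p) (far p) ⟩
      (3 + 2 * (near p + far p)) * (down p + up p)
        ≡⟨ cong (λ k → (3 + 2 * k) * (down p + up p)) (near+far p) ⟩
      5 * (down p + up p)
        ≤⟨ ℕ.*-monoʳ-≤ 5 (up+down≤1 p) ⟩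
      5 ∎
      where
      open ℕ.≤-Reasoning
      collect : ∀ d u n f → (3 * d + (n * u + n * d) + 2 * f * u) + (3 * u + (n * d + n * u) + 2 * f * d)
              ≡ (3 + 2 * (n + f)) * (d + u)
      collect = solve-∀

    -- A right angle at z keeps p and q off z, so exactly one of right-right, opposite and left-left
    -- holds, and the constant 2 is spread over these cases. Its right-right part goes in equal
    -- shares to p and q. Only the left-left case can lose something, namely when both points are
    -- far.
    pointwise : ∀ p q →
      rot z p q * (2 + opposite p q) + (rot p z q + rot p q z) * opposite p q ≤
      (isRight p * (isRight q * rot z p q) + isLeft p * leftwards p q)
        + (isRight q * (isRight p * rot z p q) + isLeft q * leftwards′ q p)
    pointwise p q = begin
      rot z p q * (2 + opposite p q) + (rot p z q + rot p q z) * opposite p q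
        ≤⟨ ℕ.+-monoˡ-≤ _ main ⟩
      rot z p q * (2 * (isRight p * isRight q) + 3 * opposite p q + 2 * (isLeft p * isLeft q * (far p + far q)))
        + (rot p z q + rot p q z) * opposite p q
        ≡⟨ collect (isLeft p) (isRight p) (isLeft q) (isRight q) (far p) (far q) (rot z p q) (rot p z q) (rot p q z) ⟩
      (isRight p * (isRight q * rot z p q) + isLeft p * leftwards p q)
        + (isRight q * (isRight p * rot z p q) + isLeft q * leftwards′ q p) ∎
      where
      open ℕ.≤-Reasoning
      collect : ∀ lp rp lq rq fp fq ρ σ τ →
        ρ * (2 * (rp * rq) + 3 * (lp * rq + rp * lq) + 2 * (lp * lq * (fp + fq))) + (σ + τ) * (lp * rq + rp * lq) ≡
        (rp * (rq * ρ) + lp * (3 * (rq * ρ) + (rq * σ + rq * τ) + 2 * fp * (lq * ρ)))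
          + (rq * (rp * ρ) + lq * (3 * (rp * ρ) + (rp * σ + rp * τ) + 2 * fq * (lp * ρ)))
      collect = solve-∀
      main : rot z p q * (2 + opposite p q) ≤
             rot z p q * (2 * (isRight p * isRight q) + 3 * opposite p q + 2 * (isLeft p * isLeft q * (far p + far q)))
      main = ⟦⟧*-mono (rotated? z p q) cases
        where
        cases : Rotated z p q → 2 + opposite p q ≤
                2 * (isRight p * isRight q) + 3 * opposite p q + 2 * (isLeft p * isLeft q * (far p + far q))
        cases r with p ≺? z | z ≺? p | side (distinct₁₂ r) | q ≺? z | z ≺? q | side (distinct₁₃ r)
        ... | yes p≺z | no _ | _ | yes q≺z | no _ | _ =
          ℕ.≤-trans (ℕ.*-monoʳ-≤ 2 (far+far r p≺z q≺z))
            (ℕ.≤-reflexive (cong (2 *_) (sym (ℕ.*-identityˡ (far p + far q)))))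
        ... | yes _ | no _  | _ | no _  | yes _ | _ = ℕ.≤-refl
        ... | no _  | yes _ | _ | yes _ | no _  | _ = ℕ.≤-refl
        ... | no _  | yes _ | _ | no _  | yes _ | _ = ℕ.≤-refl
        ... | yes _ | yes _ | inj₁ (_ , ()) | _ | _ | _
        ... | yes _ | yes _ | inj₂ (() , _) | _ | _ | _
        ... | no _  | no _  | inj₁ (() , _) | _ | _ | _
        ... | no _  | no _  | inj₂ (_ , ()) | _ | _ | _
        ... | _ | _ | _ | yes _ | yes _ | inj₁ (_ , ())
        ... | _ | _ | _ | yes _ | yes _ | inj₂ (() , _)
        ... | _ | _ | _ | no _  | no _  | inj₁ (() , _)
        ... | _ | _ | _ | no _  | no _  | inj₂ (_ , ())

    -- Pairs of right points a quarter turn apart, listed by source and by image. The two numbers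
    -- agree, which bounds their sum by twice the number of points below z (the sources) or above z
    -- (the images); as no right point is both source and image, the sum is also at most the number
    -- of right points.
    inner inner′ : ℕ
    inner  = ∑[ p < n ] (isRight p * ∑[ q < n ] (isRight q * rot z p q))
    inner′ = ∑[ p < n ] (isRight p * ∑[ q < n ] (isRight q * rot z q p))

    inner≡inner′ : inner ≡ inner′
    inner≡inner′ = begin
      ∑[ p < n ] (isRight p * ∑[ q < n ] (isRight q * rot z p q))   ≡⟨ sum-cong-≗ (λ p → *-distribˡ-sum {n} (isRight p) _) ⟩
      ∑[ p < n ] ∑[ q < n ] (isRight p * (isRight q * rot z p q))   ≡⟨ ∑-comm (λ p q → isRight p * (isRight q * rot z p q)) ⟩
      ∑[ q < n ] ∑[ p < n ] (isRight p * (isRight q * rot z p q))   ≡⟨ sum-cong-≗ (λ q → sum-cong-≗ λ p → swap (isRight p) (isRight q) (rot z p q)) ⟩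
      ∑[ q < n ] ∑[ p < n ] (isRight q * (isRight p * rot z p q))   ≡⟨ sum-cong-≗ (λ q → *-distribˡ-sum {n} (isRight q) _) ⟨
      ∑[ q < n ] (isRight q * ∑[ p < n ] (isRight p * rot z p q))   ∎
      where
      open ≡-Reasoning
      swap : ∀ a b c → a * (b * c) ≡ b * (a * c)
      swap = solve-∀

    inner≤up : inner ≤ ∑[ p < n ] up p
    inner≤up = ℕ.≤-trans (ℕ.≤-reflexive inner≡inner′)
      (∑-mono λ p → ℕ.≤-trans (⟦⟧*≤ (z ≺? p) _) (Σrotʳ′ p))

    inner≤down : inner ≤ ∑[ p < n ] down p
    inner≤down = ∑-mono λ p → ℕ.≤-trans (⟦⟧*≤ (z ≺? p) _) (Σrotʳ p)

    inner+inner′≤isRight : inner + inner′ ≤ ∑[ p < n ] isRight p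
    inner+inner′≤isRight = begin
      inner + inner′
        ≡⟨ ∑-distrib-+ (λ p → isRight p * ∑[ q < n ] (isRight q * rot z p q)) (λ p → isRight p * ∑[ q < n ] (isRight q * rot z q p)) ⟨
      ∑[ p < n ] (isRight p * ∑[ q < n ] (isRight q * rot z p q) + isRight p * ∑[ q < n ] (isRight q * rot z q p))
        ≤⟨ ∑-mono bound ⟩
      ∑[ p < n ] isRight p ∎
      where
      open ℕ.≤-Reasoning
      bound : ∀ p → isRight p * ∑[ q < n ] (isRight q * rot z p q) + isRight p * ∑[ q < n ] (isRight q * rot z q p) ≤ isRight p
      bound p = begin
        isRight p * ∑[ q < n ] (isRight q * rot z p q) + isRight p * ∑[ q < n ] (isRight q * rot z q p)
          ≡⟨ ℕ.*-distribˡ-+ (isRight p) _ _ ⟨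
        isRight p * rightwards p        ≤⟨ ℕ.*-monoʳ-≤ (isRight p) (ℕ.+-mono-≤ (Σrotʳ p) (Σrotʳ′ p)) ⟩
        isRight p * (down p + up p)     ≤⟨ ℕ.*-monoʳ-≤ (isRight p) (up+down≤1 p) ⟩
        isRight p * 1                   ≡⟨ ℕ.*-identityʳ (isRight p) ⟩
        isRight p                       ∎

    degree≤ : degree ≤ (inner + inner′) + 5 * ∑[ p < n ] isLeft p
    degree≤ = begin
      degree
        ≤⟨ ∑-mono (λ p → ∑-mono (pointwise p)) ⟩
      ∑[ p < n ] ∑[ q < n ] (f p q + g q p)
        ≡⟨ sum-cong-≗ (λ p → ∑-distrib-+ (f p) (λ q → g q p)) ⟩
      ∑[ p < n ] (∑[ q < n ] f p q + ∑[ q < n ] g q p)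
        ≡⟨ ∑-distrib-+ (λ p → ∑[ q < n ] f p q) (λ p → ∑[ q < n ] g q p) ⟩
      ∑[ p < n ] ∑[ q < n ] f p q + ∑[ p < n ] ∑[ q < n ] g q p
        ≡⟨ cong (∑[ p < n ] ∑[ q < n ] f p q +_) (∑-comm (λ p q → g q p)) ⟩
      ∑[ p < n ] ∑[ q < n ] f p q + ∑[ p < n ] ∑[ q < n ] g p q
        ≡⟨ ∑-distrib-+ (λ p → ∑[ q < n ] f p q) (λ p → ∑[ q < n ] g p q) ⟨
      ∑[ p < n ] (∑[ q < n ] f p q + ∑[ q < n ] g p q)
        ≡⟨ sum-cong-≗ regroup ⟩
      ∑[ p < n ] (i p + i′ p + isLeft p * ∑[ q < n ] (leftwards p q + leftwards′ p q))
        ≤⟨ ∑-+-≤ (λ p → i p + i′ p) _ (ℕ.≤-reflexive (∑-distrib-+ i i′))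
             (ℕ.≤-trans (∑-mono λ p → ⟦⟧*-mono (p ≺? z) Σleftwards) (ℕ.≤-reflexive total)) ⟩
      (inner + inner′) + 5 * ∑[ p < n ] isLeft p ∎
      where
      open ℕ.≤-Reasoning
      f g : Fin n → Fin n → ℕ
      f p q = isRight p * (isRight q * rot z p q) + isLeft p * leftwards p q
      g p q = isRight p * (isRight q * rot z q p) + isLeft p * leftwards′ p q
      i i′ : Fin n → ℕ
      i  p = isRight p * ∑[ q < n ] (isRight q * rot z p q)
      i′ p = isRight p * ∑[ q < n ] (isRight q * rot z q p)
      split : ∀ p (a b : Fin n → ℕ) → ∑[ q < n ] (isRight p * a q + isLeft p * b q) ≡
              isRight p * ∑[ q < n ] a q + isLeft p * ∑[ q < n ] b q
      split p a b = trans (∑-distrib-+ (λ q → isRight p * a q) (λ q → isLeft p * b q))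
        (sym (cong₂ _+_ (*-distribˡ-sum (isRight p) a) (*-distribˡ-sum (isLeft p) b)))
      rearrange : ∀ a b l x y → (a + l * x) + (b + l * y) ≡ a + b + l * (x + y)
      rearrange = solve-∀
      regroup : ∀ p → ∑[ q < n ] f p q + ∑[ q < n ] g p q ≡
                i p + i′ p + isLeft p * ∑[ q < n ] (leftwards p q + leftwards′ p q)
      regroup p = trans
        (cong₂ _+_ (split p (λ q → isRight q * rot z p q) (leftwards p))
                   (split p (λ q → isRight q * rot z q p) (leftwards′ p)))
        (trans (rearrange (i p) (i′ p) (isLeft p) _ _)
          (cong (λ s → i p + i′ p + isLeft p * s) (sym (∑-distrib-+ (leftwards p) (leftwards′ p)))))
      total : ∑[ p < n ] (isLeft p * 5) ≡ 5 * ∑[ p < n ] isLeft p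
      total = trans (sum-cong-≗ λ p → ℕ.*-comm (isLeft p) 5) (sym (*-distribˡ-sum 5 isLeft))

    degree-bound : ∃[ w ] degree ≤ w + 5 * ∑[ p < n ] isLeft p × w ≤ ∑[ p < n ] isRight p ×
                          w ≤ 2 * ∑[ p < n ] down p × w ≤ 2 * ∑[ p < n ] up p
    degree-bound = inner + inner′ , degree≤ , inner+inner′≤isRight
      , ℕ.≤-trans (ℕ.≤-reflexive twice) (ℕ.*-monoʳ-≤ 2 inner≤down)
      , ℕ.≤-trans (ℕ.≤-reflexive twice) (ℕ.*-monoʳ-≤ 2 inner≤up)
      where
      double : ∀ m → m + m ≡ 2 * m
      double = solve-∀
      twice : inner + inner′ ≡ 2 * inner
      twice = trans (cong (inner +_) (sym inner≡inner′)) (double inner)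

  -- Sums of a function of the smaller of rank and corank.

  ∑-balanced : ℕ → (ℕ → ℕ) → ℕ
  ∑-balanced n f = ∑[ i < n ] f (toℕ i ⊓ (n ∸ suc (toℕ i)))

  -- The first and the last position contribute `f 0` each; removing both lowers every other minimum
  -- by one.
  ∑-balanced-step : ∀ n f → ∑-balanced (2 + n) f ≡ 2 * f 0 + ∑-balanced n (f ∘ suc)
  ∑-balanced-step n f = begin
    f 0 + ∑[ j < suc n ] g (toℕ j)
      ≡⟨ cong (f 0 +_) (sum-init-last (λ j → g (toℕ j))) ⟩
    f 0 + (∑[ i < n ] g (toℕ (Fin.inject₁ i)) + g (toℕ (Fin.fromℕ n)))
      ≡⟨ cong (f 0 +_) (cong₂ _+_ (sum-cong-≗ inner) outer) ⟩
    f 0 + (∑-balanced n (f ∘ suc) + f 0)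
      ≡⟨ rearrange (f 0) _ ⟩
    2 * f 0 + ∑-balanced n (f ∘ suc) ∎
    where
    open ≡-Reasoning
    g : ℕ → ℕ
    g j = f (suc j ⊓ (n ∸ j))
    rearrange : ∀ a b → a + (b + a) ≡ 2 * a + b
    rearrange = solve-∀
    inner : ∀ (i : Fin n) → g (toℕ (Fin.inject₁ i)) ≡ f (suc (toℕ i ⊓ (n ∸ suc (toℕ i))))
    inner i = trans (cong g (Fin.toℕ-inject₁ i))
      (cong (λ k → f (suc (toℕ i) ⊓ k)) (ℕ.+-∸-assoc 1 (Fin.toℕ<n i)))
    outer : g (toℕ (Fin.fromℕ n)) ≡ f 0
    outer = trans (cong g (Fin.toℕ-fromℕ n)) (cong (λ k → f (suc n ⊓ k)) (ℕ.n∸n≡0 n))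

  ∑-balanced-suc : ∀ n → ∑-balanced (2 + n) (4 *_) ≡ 4 * n + ∑-balanced n (4 *_)
  ∑-balanced-suc n = begin
    ∑-balanced (2 + n) (4 *_)                          ≡⟨ ∑-balanced-step n (4 *_) ⟩
    ∑-balanced n (λ m → 4 * suc m)                     ≡⟨ sum-cong-≗ {n} (λ i → ℕ.*-suc 4 (toℕ i ⊓ (n ∸ suc (toℕ i)))) ⟩
    ∑[ i < n ] (4 + 4 * (toℕ i ⊓ (n ∸ suc (toℕ i))))   ≡⟨ ∑-distrib-+ {n} (λ _ → 4) (λ i → 4 * (toℕ i ⊓ (n ∸ suc (toℕ i)))) ⟩
    ∑[ i < n ] 4 + ∑-balanced n (4 *_)                 ≡⟨ cong (_+ ∑-balanced n (4 *_)) (trans (∑-const n 4) (ℕ.*-comm n 4)) ⟩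
    4 * n + ∑-balanced n (4 *_)                        ∎
    where open ≡-Reasoning

  -- The value is 4 g (g - 1); adding `4 * g` on the left avoids truncated subtraction.
  ∑-balanced-even : ∀ g → ∑-balanced (g + g) (4 *_) + 4 * g ≡ 4 * (g * g)
  ∑-balanced-even zero    = refl
  ∑-balanced-even (suc g) rewrite ℕ.+-suc g g = begin
    ∑-balanced (2 + (g + g)) (4 *_) + 4 * suc g                ≡⟨ cong (_+ 4 * suc g) (∑-balanced-suc (g + g)) ⟩
    4 * (g + g) + ∑-balanced (g + g) (4 *_) + 4 * suc g        ≡⟨ rearrange g _ ⟩
    (∑-balanced (g + g) (4 *_) + 4 * g) + (4 + 8 * g)          ≡⟨ cong (_+ (4 + 8 * g)) (∑-balanced-even g) ⟩
    4 * (g * g) + (4 + 8 * g)                                  ≡⟨ square g ⟩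
    4 * (suc g * suc g)                                        ∎
    where
    open ≡-Reasoning
    rearrange : ∀ g x → 4 * (g + g) + x + 4 * suc g ≡ (x + 4 * g) + (4 + 8 * g)
    rearrange = solve-∀
    square : ∀ g → 4 * (g * g) + (4 + 8 * g) ≡ 4 * (suc g * suc g)
    square = solve-∀

  ∑-balanced-odd : ∀ g → ∑-balanced (suc (g + g)) (4 *_) ≡ 4 * (g * g)
  ∑-balanced-odd zero    = refl
  ∑-balanced-odd (suc g) rewrite ℕ.+-suc g g = begin
    ∑-balanced (2 + suc (g + g)) (4 *_)                        ≡⟨ ∑-balanced-suc (suc (g + g)) ⟩
    4 * suc (g + g) + ∑-balanced (suc (g + g)) (4 *_)          ≡⟨ cong (4 * suc (g + g) +_) (∑-balanced-odd g) ⟩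
    4 * suc (g + g) + 4 * (g * g)                              ≡⟨ square g ⟩
    4 * (suc g * suc g)                                        ∎
    where
    open ≡-Reasoning
    square : ∀ g → 4 * suc (g + g) + 4 * (g * g) ≡ 4 * (suc g * suc g)
    square = solve-∀

  -- Ranks are distinct and the rank determines the corank, so the points occupy distinct positions
  -- among 0, ..., n - 1.
  ∑-rank-≤ : ∀ {n} {_≺_ : Rel (Fin n) 0ℓ} (≺-sto : IsStrictTotalOrder _≡_ _≺_) (_≺?_ : Decidable _≺_) →
             let open Rank ≺-sto _≺?_ in
             (f : ℕ → ℕ → ℕ) →
             ∑[ z < n ] f (rank z) (corank z) ≤ ∑[ i < n ] f (toℕ i) (n ∸ suc (toℕ i))
  ∑-rank-≤ {n} sto dec f = begin
    ∑[ z < n ] f (rank z) (corank z)     ≡⟨ sum-cong-≗ (λ z → cong₂ f (sym (Fin.toℕ-fromℕ< (rank<n z))) (corank≡ z)) ⟩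
    ∑[ z < n ] g (position z)            ≤⟨ ∑-injective-≤ position-injective g ⟩
    ∑[ i < n ] g i                       ∎
    where
    open Rank sto dec
    open ℕ.≤-Reasoning
    rank<n : ∀ z → rank z < n
    rank<n z = ℕ.≤-trans (s≤s (ℕ.m≤m+n (rank z) (corank z))) (ℕ.≤-reflexive (rank+corank z))
    position : Fin n → Fin n
    position z = fromℕ< (rank<n z)
    g : Fin n → ℕ
    g i = f (toℕ i) (n ∸ suc (toℕ i))
    position-injective : Injective _≡_ _≡_ position
    position-injective eq = rank-injective (Fin.fromℕ<-injective _ _ _ _ eq)
    corank≡ : ∀ z → corank z ≡ n ∸ suc (toℕ (position z))
    corank≡ z = begin-equality
      corank z                              ≡⟨ ℕ.m+n∸m≡n (suc (rank z)) (corank z) ⟨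
      suc (rank z) + corank z ∸ suc (rank z)  ≡⟨ cong (_∸ suc (rank z)) (rank+corank z) ⟩
      n ∸ suc (rank z)                      ≡⟨ cong (λ k → n ∸ suc k) (Fin.toℕ-fromℕ< (rank<n z)) ⟨
      n ∸ suc (toℕ (position z))            ∎

  -- Summation of the local bounds.

  module TotalBound {n} (C : Configuration n) where
    open Configuration C
    open Rank ≺-isStrictTotalOrder _≺?_
    open Rank ≺′-isStrictTotalOrder _≺′?_ using () renaming (rank to rank′; corank to corank′; rank+corank to rank′+corank′)
    open IsStrictTotalOrder ≺-isStrictTotalOrder using (compare) renaming (trans to ≺-trans)
    open LocalBound C using (rot; degree; opposite; isLeft; isRight)

    mirror-degree : ∀ z → LocalBound.degree (mirror C) z ≡ degree z
    mirror-degree z = sum-cong-≗ λ p → sum-cong-≗ λ q →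
      cong (λ x → rot z z p q * (2 + x) + (rot z p z q + rot z p q z) * x)
        (ℕ.+-comm (isRight z p * isLeft z q) (isLeft z p * isRight z q))

    -- A point with few points above or below it has few pairs of right
    -- neighbours; the argument is the smaller of these two numbers.
    cost : ℕ → ℕ
    cost 0             = ⌊ n /2⌋ ∸ 1
    cost 1             = ⌊ n /2⌋ ∸ 1 + 2
    cost (suc (suc _)) = n ∸ 1

    -- Two unequal numbers with sum n - 1 have the smaller one below ⌊n/2⌋. Equality occurs only at
    -- the median of an odd number of points, so in the sum over all points the indicator costs at
    -- most 1.
    minor≤ : ∀ x y → suc (x + y) ≡ n → x ≤ y → x ≤ ⌊ n /2⌋ ∸ 1 + ⟦ x ≟ y ⟧
    minor≤ x y refl x≤y with x ≟ y
    ... | yes refl = begin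
      x                            ≡⟨ ℕ.n≡⌊n+n/2⌋ x ⟩
      ⌊ x + x /2⌋                  ≤⟨ ℕ.⌊n/2⌋-mono (ℕ.n≤1+n (x + x)) ⟩
      ⌊ suc (x + x) /2⌋            ≤⟨ ℕ.m≤n+m∸n ⌊ suc (x + x) /2⌋ 1 ⟩
      1 + (⌊ suc (x + x) /2⌋ ∸ 1)  ≡⟨ ℕ.+-comm 1 _ ⟩
      ⌊ suc (x + x) /2⌋ ∸ 1 + 1    ∎
      where open ℕ.≤-Reasoning
    ... | no x≢y = begin
      x                                ≡⟨ ℕ.n≡⌊n+n/2⌋ x ⟩
      ⌊ x + x /2⌋                      ≤⟨ ℕ.∸-monoˡ-≤ 1 (ℕ.⌊n/2⌋-mono (s≤s (ℕ.≤-trans (ℕ.≤-reflexive (sym (ℕ.+-suc x x))) (ℕ.+-monoʳ-≤ x (ℕ.≤∧≢⇒< x≤y x≢y))))) ⟩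
      ⌊ suc (x + y) /2⌋ ∸ 1            ≡⟨ ℕ.+-identityʳ _ ⟨
      ⌊ suc (x + y) /2⌋ ∸ 1 + 0        ∎
      where open ℕ.≤-Reasoning

    -- Of 5 x only 4 x is kept apart; the remaining x is added to w. In general x + w ≤ x + y = n -
    -- 1, but if w ≤ 2 k is small, then x itself, at most about n / 2, dominates, and this is the
    -- saving.
    minor-bound : ∀ {d w x y k} → suc (x + y) ≡ n → x ≤ y →
                  d ≤ w + 5 * x → w ≤ y → w ≤ 2 * k → d ≤ 4 * x + ⟦ x ≟ y ⟧ + cost k
    minor-bound {d} {w} {x} {y} {0} x+y x≤y d≤ w≤y w≤2k = begin
      d                                                ≤⟨ d≤ ⟩
      w + 5 * x                                        ≤⟨ ℕ.+-monoˡ-≤ (5 * x) w≤2k ⟩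
      5 * x                                            ≡⟨ split x ⟩
      4 * x + x                                        ≤⟨ ℕ.+-monoʳ-≤ (4 * x) (minor≤ x y x+y x≤y) ⟩
      4 * x + (⌊ n /2⌋ ∸ 1 + ⟦ x ≟ y ⟧)                ≡⟨ rearrange (4 * x) (⌊ n /2⌋ ∸ 1) ⟦ x ≟ y ⟧ ⟩
      4 * x + ⟦ x ≟ y ⟧ + (⌊ n /2⌋ ∸ 1)                ∎
      where
      open ℕ.≤-Reasoning
      split : ∀ x → 5 * x ≡ 4 * x + x
      split = solve-∀
      rearrange : ∀ a b c → a + (b + c) ≡ a + c + b
      rearrange = solve-∀
    minor-bound {d} {w} {x} {y} {1} x+y x≤y d≤ w≤y w≤2k = begin
      d                                                ≤⟨ d≤ ⟩
      w + 5 * x                                        ≤⟨ ℕ.+-monoˡ-≤ (5 * x) w≤2k ⟩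
      2 + 5 * x                                        ≡⟨ split x ⟩
      4 * x + 2 + x                                    ≤⟨ ℕ.+-monoʳ-≤ (4 * x + 2) (minor≤ x y x+y x≤y) ⟩
      4 * x + 2 + (⌊ n /2⌋ ∸ 1 + ⟦ x ≟ y ⟧)            ≡⟨ rearrange (4 * x) (⌊ n /2⌋ ∸ 1) ⟦ x ≟ y ⟧ ⟩
      4 * x + ⟦ x ≟ y ⟧ + (⌊ n /2⌋ ∸ 1 + 2)            ∎
      where
      open ℕ.≤-Reasoning
      split : ∀ x → 2 + 5 * x ≡ 4 * x + 2 + x
      split = solve-∀
      rearrange : ∀ a b c → a + 2 + (b + c) ≡ a + c + (b + 2)
      rearrange = solve-∀
    minor-bound {d} {w} {x} {y} {suc (suc _)} x+y x≤y d≤ w≤y w≤2k = begin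
      d                                  ≤⟨ d≤ ⟩
      w + 5 * x                          ≤⟨ ℕ.+-monoˡ-≤ (5 * x) w≤y ⟩
      y + 5 * x                          ≡⟨ split x y ⟩
      4 * x + (x + y)                    ≡⟨ cong (λ k → 4 * x + (k ∸ 1)) x+y ⟩
      4 * x + (n ∸ 1)                    ≤⟨ ℕ.+-monoˡ-≤ (n ∸ 1) (ℕ.m≤m+n (4 * x) ⟦ x ≟ y ⟧) ⟩
      4 * x + ⟦ x ≟ y ⟧ + (n ∸ 1)        ∎
      where
      open ℕ.≤-Reasoning
      split : ∀ x y → y + 5 * x ≡ 4 * x + (x + y)
      split = solve-∀

    one-sided-bound : ∀ {d x y} u v → suc (x + y) ≡ n → x ≤ y →
      (∃[ w ] d ≤ w + 5 * x × w ≤ y × w ≤ 2 * u × w ≤ 2 * v) → d ≤ 4 * (x ⊓ y) + ⟦ x ≟ y ⟧ + cost (u ⊓ v)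
    one-sided-bound {d} {x} {y} u v x+y x≤y (w , d≤ , w≤y , w≤2u , w≤2v) =
      subst (λ m → d ≤ 4 * m + ⟦ x ≟ y ⟧ + cost (u ⊓ v)) (sym (ℕ.m≤n⇒m⊓n≡m x≤y))
        (minor-bound {k = u ⊓ v} x+y x≤y d≤ w≤y
          (ℕ.≤-trans (ℕ.⊓-glb w≤2u w≤2v) (ℕ.≤-reflexive (sym (ℕ.*-distribˡ-⊓ 2 u v)))))

    bound-swap : ∀ {d} x y u v → d ≤ 4 * (y ⊓ x) + ⟦ y ≟ x ⟧ + cost (v ⊓ u) → d ≤ 4 * (x ⊓ y) + ⟦ x ≟ y ⟧ + cost (u ⊓ v)
    bound-swap x y u v d≤ rewrite ℕ.⊓-comm x y | ℕ.⊓-comm u v =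
      ℕ.≤-trans d≤ (ℕ.+-monoˡ-≤ (cost (v ⊓ u)) (ℕ.+-monoʳ-≤ (4 * (y ⊓ x)) (⟦⟧-mono (y ≟ x) (x ≟ y) sym)))

    -- Nothing is known about how the horizontal and the vertical rank of a point are related. The
    -- bound is therefore a function of one plus a function of the other, and each can be summed
    -- along its own order.
    degree-bound : ∀ z → degree z ≤
      (4 * (rank z ⊓ corank z) + ⟦ rank z ≟ corank z ⟧) + cost (rank′ z ⊓ corank′ z)
    degree-bound z = [ below , above ]′ (ℕ.≤-total (rank z) (corank z))
      where
      below : rank z ≤ corank z → _
      below l≤r = one-sided-bound (rank′ z) (corank′ z) (rank+corank z) l≤r (LocalBound.degree-bound C z)
      above : corank z ≤ rank z → _
      above r≤l = bound-swap (rank z) (corank z) (rank′ z) (corank′ z)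
        (subst (_≤ 4 * (corank z ⊓ rank z) + ⟦ corank z ≟ rank z ⟧ + cost (corank′ z ⊓ rank′ z)) (mirror-degree z)
          (one-sided-bound (corank′ z) (rank′ z) (trans (cong suc (ℕ.+-comm (corank z) (rank z))) (rank+corank z)) r≤l
            (LocalBound.degree-bound (mirror C) z)))

    ∑degree≤ : ∑[ z < n ] degree z ≤ ∑-balanced n (4 *_) + 1 + ∑-balanced n cost
    ∑degree≤ = begin
      ∑[ z < n ] degree z
        ≤⟨ ∑-mono degree-bound ⟩
      ∑[ z < n ] (f (rank z) (corank z) + cost (rank′ z ⊓ corank′ z))
        ≤⟨ ∑-+-≤ (λ z → f (rank z) (corank z)) _
             (∑-rank-≤ ≺-isStrictTotalOrder _≺?_ f)
             (∑-rank-≤ ≺′-isStrictTotalOrder _≺′?_ (λ x y → cost (x ⊓ y))) ⟩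
      ∑[ i < n ] f (toℕ i) (n ∸ suc (toℕ i)) + ∑-balanced n cost
        ≤⟨ ℕ.+-monoˡ-≤ _ (∑-+-≤ {n} _ _ ℕ.≤-refl
             (∑-subsingleton _ (λ {i} {j} p q → middle i j (0<⟦⟧⇒ _ p) (0<⟦⟧⇒ _ q)) (λ i → ⟦ _ ⟧≤1))) ⟩
      ∑-balanced n (4 *_) + 1 + ∑-balanced n cost ∎
      where
      open ℕ.≤-Reasoning
      f : ℕ → ℕ → ℕ
      f x y = 4 * (x ⊓ y) + ⟦ x ≟ y ⟧
      middle-size : ∀ (i : Fin n) → toℕ i ≡ n ∸ suc (toℕ i) → n ≡ suc (toℕ i + toℕ i)
      middle-size i e = trans (sym (ℕ.m+[n∸m]≡n (Fin.toℕ<n i))) (cong (λ k → suc (toℕ i + k)) (sym e))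
      middle : ∀ i j → toℕ i ≡ n ∸ suc (toℕ i) → toℕ j ≡ n ∸ suc (toℕ j) → i ≡ j
      middle i j ei ej = Fin.toℕ-injective (ℕ.*-cancelˡ-≡ (toℕ i) (toℕ j) 2
        (trans (double (toℕ i)) (trans (ℕ.suc-injective (trans (sym (middle-size i ei)) (middle-size j ej)))
          (sym (double (toℕ j))))))
        where
        double : ∀ m → 2 * m ≡ m + m
        double = solve-∀

    count≤∑degree : 3 * ∑³ (λ a b c → ⟦ rotated? a b c ⟧) ≤ ∑[ z < n ] degree z
    count≤∑degree = begin
      3 * ∑³ (λ a b c → ⟦ rotated? a b c ⟧)
        ≡⟨ distrib ⟩
      ∑³ (λ a b c → ⟦ rotated? a b c ⟧ * 3)
        ≤⟨ ∑³-mono pointwise ⟩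
      ∑³ (λ a b c → u a b c + (v b a c + w c a b))
        ≡⟨ ∑³-+ u (λ a b c → v b a c + w c a b) ⟩
      ∑³ u + ∑³ (λ a b c → v b a c + w c a b)
        ≡⟨ cong (∑³ u +_) (∑³-+ (λ a b c → v b a c) (λ a b c → w c a b)) ⟩
      ∑³ u + (∑³ (λ a b c → v b a c) + ∑³ (λ a b c → w c a b))
        ≡⟨ cong (∑³ u +_) (cong₂ _+_ (∑³-swapˡ (λ a b c → v b a c))
             (trans (∑³-swapʳ (λ a b c → w c a b)) (∑³-swapˡ (λ a b c → w b a c)))) ⟩
      ∑³ u + (∑³ v + ∑³ w)
        ≡⟨ cong (∑³ u +_) (∑³-+ v w) ⟨
      ∑³ u + ∑³ (λ z p q → v z p q + w z p q)
        ≡⟨ ∑³-+ u (λ z p q → v z p q + w z p q) ⟨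
      ∑³ (λ z p q → u z p q + (v z p q + w z p q))
        ≡⟨ ∑³-cong (λ z p q → cong (u z p q +_)
             (ℕ.*-distribʳ-+ (opposite z p q) ⟦ rotated? p z q ⟧ ⟦ rotated? p q z ⟧)) ⟨
      ∑[ z < n ] degree z ∎
      where
      open ℕ.≤-Reasoning
      -- Every `Rotated a b c` is worth 3: 2 at its centre a and 1 at its middle vertex. `v` and `w`
      -- read the triangle from b and from c, so that exchanging variables makes the vertex that is
      -- paid the outermost one.
      u v w : Fin n → Fin n → Fin n → ℕ
      u z p q = ⟦ rotated? z p q ⟧ * (2 + opposite z p q)
      v z p q = ⟦ rotated? p z q ⟧ * opposite z p q
      w z p q = ⟦ rotated? p q z ⟧ * opposite z p q
      distrib : 3 * ∑³ (λ a b c → ⟦ rotated? a b c ⟧) ≡ ∑³ (λ a b c → ⟦ rotated? a b c ⟧ * 3)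
      distrib = trans (*-distribˡ-sum {n} 3 _) (sum-cong-≗ λ a → trans (*-distribˡ-sum {n} 3 _)
        (sum-cong-≗ λ b → trans (*-distribˡ-sum {n} 3 _) (sum-cong-≗ λ c → ℕ.*-comm 3 ⟦ rotated? a b c ⟧)))

      opposite≥ : ∀ {z p q} → p ≺ z → z ≺ q → 1 ≤ opposite z p q
      opposite≥ {z} {p} {q} p≺z z≺q = ℕ.≤-trans
        (ℕ.*-mono-≤ (1≤⟦ p ≺? z ⟧ p≺z) (1≤⟦ z ≺? q ⟧ z≺q)) (ℕ.m≤m+n _ _)
      opposite≥′ : ∀ {z p q} → q ≺ z → z ≺ p → 1 ≤ opposite z p q
      opposite≥′ {z} {p} {q} q≺z z≺p = ℕ.≤-trans
        (ℕ.*-mono-≤ (1≤⟦ z ≺? p ⟧ z≺p) (1≤⟦ q ≺? z ⟧ q≺z)) (ℕ.m≤n+m _ _)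

      middle : ∀ {a b c} → Rotated a b c → 1 ≤ opposite a b c + opposite b a c + opposite c a b
      middle {a} {b} {c} r = conclude
        where
        x y t : ℕ
        x = opposite a b c
        y = opposite b a c
        t = opposite c a b
        first : 1 ≤ x → 1 ≤ x + y + t
        first h = ℕ.≤-trans h (ℕ.≤-trans (ℕ.m≤m+n x y) (ℕ.m≤m+n (x + y) t))
        second : 1 ≤ y → 1 ≤ x + y + t
        second h = ℕ.≤-trans h (ℕ.≤-trans (ℕ.m≤n+m y x) (ℕ.m≤m+n (x + y) t))
        third : 1 ≤ t → 1 ≤ x + y + t
        third h = ℕ.≤-trans h (ℕ.m≤n+m t (x + y))
        conclude : 1 ≤ x + y + t
        conclude with compare a b | compare a c | compare b c
        ... | tri≈ _ a≡b _ | _ | _ = ⊥-elim (distinct₁₂ r a≡b)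
        ... | tri< _ _ _ | tri≈ _ a≡c _ | _ = ⊥-elim (distinct₁₃ r a≡c)
        ... | tri> _ _ _ | tri≈ _ a≡c _ | _ = ⊥-elim (distinct₁₃ r a≡c)
        ... | tri> _ _ b≺a | tri< a≺c _ _ | _ = first (opposite≥ b≺a a≺c)
        ... | tri< a≺b _ _ | tri> _ _ c≺a | _ = first (opposite≥′ c≺a a≺b)
        ... | tri< _ _ _ | tri< _ _ _ | tri≈ _ b≡c _ = ⊥-elim (distinct₂₃ r b≡c)
        ... | tri> _ _ _ | tri> _ _ _ | tri≈ _ b≡c _ = ⊥-elim (distinct₂₃ r b≡c)
        ... | tri< a≺b _ _ | tri< _ _ _ | tri< b≺c _ _ = second (opposite≥ a≺b b≺c)
        ... | tri> _ _ b≺a | tri> _ _ _ | tri> _ _ c≺b = second (opposite≥′ c≺b b≺a)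
        ... | tri< _ _ _ | tri< a≺c _ _ | tri> _ _ c≺b = third (opposite≥ a≺c c≺b)
        ... | tri> _ _ _ | tri> _ _ c≺a | tri< b≺c _ _ = third (opposite≥′ b≺c c≺a)

      pointwise : ∀ a b c → ⟦ rotated? a b c ⟧ * 3 ≤ u a b c + (v b a c + w c a b)
      pointwise a b c = ℕ.≤-trans
        (⟦⟧*-mono (rotated? a b c) λ r → ℕ.+-monoʳ-≤ 2 (middle r))
        (ℕ.≤-reflexive (collect ⟦ rotated? a b c ⟧ (opposite a b c) (opposite b a c) (opposite c a b)))
        where
        collect : ∀ ρ x y z → ρ * (2 + (x + y + z)) ≡ ρ * (2 + x) + (ρ * y + ρ * z)
        collect = solve-∀

  -- Arithmetic of the summed bound.

  halves : ∀ n → ∃[ g ] (n ≡ g + g ⊎ n ≡ suc (g + g))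
  halves zero = 0 , inj₁ refl
  halves (suc n) with halves n
  ... | g , inj₁ eq = g , inj₂ (cong suc eq)
  ... | g , inj₂ eq = suc g , inj₁ (trans (cong suc eq) (cong suc (sym (ℕ.+-suc g g))))

  ∑-balanced-constant : ∀ {n k c} (f : ℕ → ℕ) → n ≡ 4 + k → (∀ i → f (2 + i) ≡ c) →
                        ∑-balanced n f ≡ 2 * f 0 + (2 * f 1 + k * c)
  ∑-balanced-constant {k = k} {c} f refl f≡c = begin
    ∑-balanced (4 + k) f                                            ≡⟨ ∑-balanced-step (2 + k) f ⟩
    2 * f 0 + ∑-balanced (2 + k) (λ i → f (1 + i))                  ≡⟨ cong (2 * f 0 +_) (∑-balanced-step k (λ i → f (1 + i))) ⟩
    2 * f 0 + (2 * f 1 + ∑-balanced k (λ i → f (2 + i)))            ≡⟨ cong (λ x → 2 * f 0 + (2 * f 1 + x)) (sum-cong-≗ {k} (λ _ → f≡c _)) ⟩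
    2 * f 0 + (2 * f 1 + ∑[ i < k ] c)                              ≡⟨ cong (λ x → 2 * f 0 + (2 * f 1 + x)) (∑-const k c) ⟩
    2 * f 0 + (2 * f 1 + k * c)                                     ∎
    where open ≡-Reasoning

  -- For g = 0, that is for n = 5 and n = 6, the bounds leave room only because s is an integer.
  odd-bound : ∀ g s → let k = g + g in
    3 * s ≤ 4 * ((2 + g) * (2 + g)) + 1 + (2 * (1 + g) + (2 * (1 + g + 2) + (1 + k) * (4 + k))) →
    3 * s + 5 ≤ 2 * ((4 + k) * (4 + k))
  odd-bound g s bound = conclude g (ℕ.≤-trans bound (ℕ.≤-reflexive (collect g)))
    where
    collect : ∀ g → 4 * ((2 + g) * (2 + g)) + 1 + (2 * (1 + g) + (2 * (1 + g + 2) + (1 + (g + g)) * (4 + (g + g)))) ≡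
              8 * (g * g) + 30 * g + 29
    collect = solve-∀
    expand : ∀ g → 8 * (suc g * suc g) + 30 * suc g + 29 + 5 + 2 * g ≡ 2 * ((4 + (suc g + suc g)) * (4 + (suc g + suc g)))
    expand = solve-∀
    conclude : ∀ g → 3 * s ≤ 8 * (g * g) + 30 * g + 29 → 3 * s + 5 ≤ 2 * ((4 + (g + g)) * (4 + (g + g)))
    -- Here 3 s ≤ 29 gives s ≤ 9, and 3 · 9 + 5 = 32 = 2 · 4² leaves no room.
    conclude zero    3s≤29 = ℕ.+-monoˡ-≤ 5 (ℕ.*-monoʳ-≤ 3 (ℕ.≤-pred (ℕ.*-cancelˡ-< 3 s 10 (s≤s 3s≤29))))
    conclude (suc g) 3s≤   = ℕ.≤-trans (ℕ.+-monoˡ-≤ 5 3s≤) (ℕ.≤-trans (ℕ.m≤m+n _ (2 * g)) (ℕ.≤-reflexive (expand g)))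

  -- The case of 6 + 2 g points; `t` stands for the sum of four times the smaller rank, known
  -- through an equation without subtraction.
  even-bound : ∀ g s t → let k = suc (g + g) in
    t + 4 * (3 + g) ≡ 4 * ((3 + g) * (3 + g)) →
    3 * s ≤ t + 1 + (2 * (2 + g) + (2 * (2 + g + 2) + (1 + k) * (4 + k))) →
    3 * s + 5 ≤ 2 * ((4 + k) * (4 + k))
  even-bound g s t t≡ bound = conclude g (ℕ.+-cancelʳ-≤ (4 * (3 + g)) _ _ (begin
    3 * s + 4 * (3 + g)                             ≤⟨ ℕ.+-monoˡ-≤ (4 * (3 + g)) bound ⟩
    t + 1 + c + 4 * (3 + g)                         ≡⟨ rearrange t c (4 * (3 + g)) ⟩
    (t + 4 * (3 + g)) + (1 + c)                     ≡⟨ cong (_+ (1 + c)) t≡ ⟩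
    4 * ((3 + g) * (3 + g)) + (1 + c)               ≡⟨ collect g ⟩
    8 * (g * g) + 38 * g + 47 + 4 * (3 + g)         ∎))
    where
    open ℕ.≤-Reasoning
    c = 2 * (2 + g) + (2 * (2 + g + 2) + (2 + (g + g)) * (5 + (g + g)))
    rearrange : ∀ a b c → a + 1 + b + c ≡ (a + c) + (1 + b)
    rearrange = solve-∀
    collect : ∀ g → 4 * ((3 + g) * (3 + g)) + (1 + (2 * (2 + g) + (2 * (2 + g + 2) + (2 + (g + g)) * (5 + (g + g))))) ≡
              8 * (g * g) + 38 * g + 47 + 4 * (3 + g)
    collect = solve-∀
    expand : ∀ g → 8 * (suc g * suc g) + 38 * suc g + 47 + 5 + 2 * g ≡ 2 * ((5 + (suc g + suc g)) * (5 + (suc g + suc g)))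
    expand = solve-∀
    conclude : ∀ g → 3 * s ≤ 8 * (g * g) + 38 * g + 47 → 3 * s + 5 ≤ 2 * ((5 + (g + g)) * (5 + (g + g)))
    -- Here 3 s ≤ 47 gives s ≤ 15, and 3 · 15 + 5 = 50 = 2 · 5² is again exact.
    conclude zero    3s≤47 = ℕ.+-monoˡ-≤ 5 (ℕ.*-monoʳ-≤ 3 (ℕ.≤-pred (ℕ.*-cancelˡ-< 3 s 16 (s≤s 3s≤47))))
    conclude (suc g) 3s≤   = ℕ.≤-trans (ℕ.+-monoˡ-≤ 5 3s≤) (ℕ.≤-trans (ℕ.m≤m+n _ (2 * g)) (ℕ.≤-reflexive (expand g)))

  quadratic-bound : ∀ {n k s} (C : Configuration n) → n ≡ 5 + k →
    3 * s ≤ ∑[ z < n ] LocalBound.degree C z → 3 * s + 5 ≤ 2 * ((4 + k) * (4 + k))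
  quadratic-bound {n} {k} {s} C n≡5+k bound = [ odd , even ]′ (proj₂ (halves k))
    where
    -- With n = 5 + k the expression `⌊ n /2⌋ ∸ 1` in `cost` computes to `1 + h`.
    h = ⌊ suc k /2⌋
    total : 3 * s ≤ ∑-balanced n (4 *_) + 1 + (2 * (1 + h) + (2 * (1 + h + 2) + (1 + k) * (4 + k)))
    total = ℕ.≤-trans bound (ℕ.≤-trans (TotalBound.∑degree≤ C) (ℕ.+-monoʳ-≤ (∑-balanced n (4 *_) + 1) (ℕ.≤-reflexive
      (trans (∑-balanced-constant (TotalBound.cost C) n≡5+k (λ _ → refl))
        (cong (λ m → 2 * (⌊ m /2⌋ ∸ 1) + (2 * (⌊ m /2⌋ ∸ 1 + 2) + (1 + k) * (m ∸ 1))) n≡5+k)))))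
    g = proj₁ (halves k)
    -- The names `odd` and `even` refer to the parity of 5 + k, not of k.
    odd : k ≡ g + g → 3 * s + 5 ≤ 2 * ((4 + k) * (4 + k))
    odd k≡ = subst (λ k → 3 * s + 5 ≤ 2 * ((4 + k) * (4 + k))) (sym k≡) (odd-bound g s
      (subst₂ (λ t k → 3 * s ≤ t + 1 + (2 * (1 + g) + (2 * (1 + g + 2) + (1 + k) * (4 + k))))
        (trans (cong (λ m → ∑-balanced m (4 *_)) (trans n≡5+k (trans (cong (5 +_) k≡) (size g)))) (∑-balanced-odd (2 + g)))
        k≡
        (subst (λ h → 3 * s ≤ ∑-balanced n (4 *_) + 1 + (2 * (1 + h) + (2 * (1 + h + 2) + (1 + k) * (4 + k))))
          (trans (cong (λ k → ⌊ suc k /2⌋) k≡) (sym (ℕ.n≡⌈n+n/2⌉ g))) total)))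
      where
      size : ∀ g → 5 + (g + g) ≡ suc (2 + g + (2 + g))
      size = solve-∀
    even : k ≡ suc (g + g) → 3 * s + 5 ≤ 2 * ((4 + k) * (4 + k))
    even k≡ = subst (λ k → 3 * s + 5 ≤ 2 * ((4 + k) * (4 + k))) (sym k≡) (even-bound g s (∑-balanced n (4 *_))
      (trans (cong (λ m → ∑-balanced m (4 *_) + 4 * (3 + g)) (trans n≡5+k (trans (cong (5 +_) k≡) (size g))))
        (∑-balanced-even (3 + g)))
      (subst₂ (λ h k → 3 * s ≤ ∑-balanced n (4 *_) + 1 + (2 * (1 + h) + (2 * (1 + h + 2) + (1 + k) * (4 + k))))
        (trans (cong (λ k → ⌊ suc k /2⌋) k≡) (cong suc (sym (ℕ.n≡⌊n+n/2⌋ g)))) k≡ total))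
      where
      size : ∀ g → 5 + suc (g + g) ≡ 3 + g + (3 + g)
      size = solve-∀

open Rotations

-- Quarter turns and orders in an abstract plane.

module Planes where
  import Algebra.Properties.AbelianGroup as AbelianGroupProperties

  -- J is the rotation by a right angle and H the positive cone of a linear order,
  -- a half-plane together with one of the rays bounding it.
  record Plane : Set₁ where
    field
      vectors : AbelianGroup 0ℓ 0ℓ
    open AbelianGroup vectors public
    field
      J      : Carrier → Carrier
      J-cong : ∀ {x y} → x ≈ y → J x ≈ J y
      J-∙    : ∀ x y → J (x ∙ y) ≈ J x ∙ J y
      J-J    : ∀ x → J (J x) ≈ x ⁻¹
      H       : Carrier → Set
      H-resp  : ∀ {x y} → x ≈ y → H x → H y
      H-∙     : ∀ {x y} → H x → H y → H (x ∙ y)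
      ¬H-ε    : ¬ H ε
      H-total : ∀ {x} → ¬ H x → ¬ H (x ⁻¹) → x ≈ ε

  module PlaneProperties (E : Plane) where
    open Plane E renaming (refl to ≈-refl; sym to ≈-sym; trans to ≈-trans)
    open AbelianGroupProperties vectors
    open import Relation.Binary.Reasoning.Setoid setoid

    ¬H-inverse : ∀ {x y} → x ∙ y ≈ ε → H x → ¬ H y
    ¬H-inverse xy≈ε hx hy = ¬H-ε (H-resp xy≈ε (H-∙ hx hy))

    J-ε : J ε ≈ ε
    J-ε = identityˡ-unique (J ε) (J ε) (≈-trans (≈-sym (J-∙ ε ε)) (J-cong (identityˡ ε)))

    J-injective-ε : ∀ {x} → J x ≈ ε → x ≈ ε
    J-injective-ε {x} Jx≈ε = begin
      x             ≈⟨ ⁻¹-involutive x ⟨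
      x ⁻¹ ⁻¹       ≈⟨ ⁻¹-cong (≈-sym (J-J x)) ⟩
      J (J x) ⁻¹    ≈⟨ ⁻¹-cong (J-cong Jx≈ε) ⟩
      J ε ⁻¹        ≈⟨ ⁻¹-cong J-ε ⟩
      ε ⁻¹          ≈⟨ ε⁻¹≈ε ⟩
      ε             ∎

    -- Applying `J` twice gives x = - x, which a group with elements of order 2 would allow; here x
    -- and - x cannot both be positive, nor can just one of them be.
    J-fixed : ∀ {x} → J x ≈ x → x ≈ ε
    J-fixed {x} Jx≈x = H-total
      (λ hx → ¬H-inverse (inverseʳ x) hx (H-resp x≈x⁻¹ hx))
      (λ hx⁻¹ → ¬H-inverse (inverseˡ x) hx⁻¹ (H-resp (≈-sym x≈x⁻¹) hx⁻¹))
      where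
      x≈x⁻¹ : x ≈ x ⁻¹
      x≈x⁻¹ = begin
        x        ≈⟨ Jx≈x ⟨
        J x      ≈⟨ J-cong (≈-sym Jx≈x) ⟩
        J (J x)  ≈⟨ J-J x ⟩
        x ⁻¹     ∎

    -- The relation of Chasles for the vectors from z to p. Keeping `d` general lets the same lemmas
    -- serve the plane, its half turn `flip d`, and the quarter-turned vectors that define the
    -- vertical order.
    Displacement : ∀ {n} → (Fin n → Fin n → Carrier) → Set
    Displacement d = ∀ z p q → d z p ∙ d p q ≈ d z q

    module _ {n} {d : Fin n → Fin n → Carrier} (chasles : Displacement d) where

      displacement-ε : ∀ z → d z z ≈ ε
      displacement-ε z = identityˡ-unique (d z z) (d z z) (chasles z z z)

      displacement-flip : ∀ z p → d z p ∙ d p z ≈ ε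
      displacement-flip z p = ≈-trans (chasles z p z) (displacement-ε z)

      displacement-inverse : ∀ z p → d p z ≈ d z p ⁻¹
      displacement-inverse z p = inverseʳ-unique (d z p) (d p z) (displacement-flip z p)

      ≺-isStrictTotalOrder : (∀ {z p} → d z p ≈ ε → z ≡ p) → (∀ z p → Dec (H (d z p))) →
                             IsStrictTotalOrder _≡_ (λ z p → H (d z p))
      ≺-isStrictTotalOrder separated H? = record
        { isStrictPartialOrder = record
          { isEquivalence = ≡.isEquivalence
          ; irrefl        = λ { {z} refl h → ¬H-ε (H-resp (displacement-ε z) h) }
          ; trans         = λ {z} {p} {q} h h′ → H-resp (chasles z p q) (H-∙ h h′)
          ; <-resp-≈      = (λ { refl h → h }) , (λ { refl h → h })
          }
        ; compare = compare
        }
        where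
        compare : ∀ z p → _
        compare z p with H? z p | H? p z
        ... | yes h | _ = tri< h (λ { refl → ¬H-ε (H-resp (displacement-ε z) h) })
                                (¬H-inverse (displacement-flip z p) h)
        ... | no ¬h | yes h = tri> ¬h (λ { refl → ¬H-ε (H-resp (displacement-ε z) h) }) h
        ... | no ¬h | no ¬h′ = tri≈ ¬h
          (separated (H-total ¬h (¬h′ ∘ H-resp (≈-sym (displacement-inverse z p))))) ¬h′

      module _ {Rotated : Fin n → Fin n → Fin n → Set}
               (rotated⇒ : ∀ {z p q} → Rotated z p q → J (d z p) ≈ d z q)
               (H⁻? : ∀ z p → Dec (H (d z p ∙ J (d p z))))
               (H⁺? : ∀ z p → Dec (H (d z p ∙ J (d z p)))) where

        rotated-back : ∀ {z p q} → Rotated z p q → J (d z q) ≈ d p z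
        rotated-back {z} {p} {q} r = begin
          J (d z q)      ≈⟨ J-cong (≈-sym (rotated⇒ r)) ⟩
          J (J (d z p))  ≈⟨ J-J (d z p) ⟩
          d z p ⁻¹       ≈⟨ displacement-inverse z p ⟨
          d p z          ∎

        J-flip : ∀ z p → J (d p z) ≈ J (d z p) ⁻¹
        J-flip z p = inverseʳ-unique (J (d z p)) (J (d p z)) (begin
          J (d z p) ∙ J (d p z)   ≈⟨ J-∙ (d z p) (d p z) ⟨
          J (d z p ∙ d p z)       ≈⟨ J-cong (displacement-flip z p) ⟩
          J ε                     ≈⟨ J-ε ⟩
          ε                       ∎)

        rotated-flip : ∀ {z p q} → Rotated z p q → J (d p z) ≈ d q z
        rotated-flip {z} {p} {q} r = begin
          J (d p z)     ≈⟨ J-flip z p ⟩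
          J (d z p) ⁻¹  ≈⟨ ⁻¹-cong (rotated⇒ r) ⟩
          d z q ⁻¹      ≈⟨ displacement-inverse z q ⟨
          d q z         ∎

        rotated-back-flip : ∀ {z p q} → Rotated z p q → J (d q z) ≈ d z p
        rotated-back-flip {z} {p} {q} r = begin
          J (d q z)     ≈⟨ J-flip z q ⟩
          J (d z q) ⁻¹  ≈⟨ ⁻¹-cong (rotated-back r) ⟩
          d p z ⁻¹      ≈⟨ displacement-inverse p z ⟨
          d z p         ∎

        private
          -- `J (d p z)` and `J (d z p)` are the vector zp turned clockwise and counterclockwise.
          -- For p on the left, adding the turned vector to zp gives a sum pointing right when p is
          -- within 45° of the vertical, above z in the first alternative and below z in the second.
          -- The bounding ray in `H` makes one diagonal near and the other far, so that `¬both-near`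
          -- also holds for points on the diagonals.
          Near : Rel (Fin n) 0ℓ
          Near z p = H (d z p ∙ J (d p z)) ⊎ H (d z p ∙ J (d z p))

          -- In a triangle with an acute angle at z the vector x = ± J (zp) is
          -- ± pq if zp is a leg, and ± (zq + pq) if zp is the hypotenuse.
          cross-leg : ∀ {z p q} {x} → H (d p z) → H (d z q) → x ≈ d p q → H x × H (d z p ∙ x)
          cross-leg {z} {p} {q} hp hq x≈ =
            H-resp (≈-trans (chasles p z q) (≈-sym x≈)) (H-∙ hp hq) ,
            H-resp (≈-trans (≈-sym (chasles z p q)) (∙-congˡ (≈-sym x≈))) hq

          cross-hypotenuse : ∀ {z p q} {x} → H (d p z) → H (d z q) → x ≈ d p q ∙ d z q → H x × H (d z p ∙ x)
          cross-hypotenuse {z} {p} {q} {x} hp hq x≈ =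
            H-resp (≈-sym x≈) (H-∙ (H-resp (chasles p z q) (H-∙ hp hq)) hq) ,
            H-resp (begin
              d z q ∙ d z q              ≈⟨ ∙-congʳ (chasles z p q) ⟨
              d z p ∙ d p q ∙ d z q      ≈⟨ assoc (d z p) (d p q) (d z q) ⟩
              d z p ∙ (d p q ∙ d z q)    ≈⟨ ∙-congˡ x≈ ⟨
              d z p ∙ x                  ∎) (H-∙ hq hq)

          J-split : ∀ z p q → J (d z q) ≈ J (d z p) ∙ J (d p q)
          J-split z p q = ≈-trans (J-cong (≈-sym (chasles z p q))) (J-∙ (d z p) (d p q))

          -- If p is on the left, nearness forces the turned vector x to point right: x is the sum
          -- of pz and zp + x. But x is zq, which points left.
          apart : ∀ {z p q} {x} → x ≈ d z q → H (d p z) → H (d q z) → ¬ H (d z p ∙ x)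
          apart {z} {p} {q} {x} x≈ hp hq h = ¬H-inverse (displacement-flip z q)
            (H-resp (begin
              d p z ∙ (d z p ∙ x)   ≈⟨ assoc (d p z) (d z p) x ⟨
              d p z ∙ d z p ∙ x     ≈⟨ ∙-congʳ (displacement-flip p z) ⟩
              ε ∙ x                 ≈⟨ identityˡ x ⟩
              x                     ≈⟨ x≈ ⟩
              d z q                 ∎) (H-∙ hp h)) hq

        sided : Sided (λ z p → H (d z p)) (λ z p → H (J (d p z))) Rotated
        sided = record
          { Near  = Near
          ; near? = λ z p → H⁻? z p ⊎-dec H⁺? z p
          ; rotate-≻ˡ = λ r → H-resp (≈-sym (rotated-back-flip r))
          ; rotate-≻ʳ = λ r → H-resp (≈-sym (rotated⇒ r))
          ; rotate-≺ˡ = λ r → H-resp (≈-sym (rotated-back r))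
          ; rotate-≺ʳ = λ r → H-resp (≈-sym (rotated-flip r))
          ; cross-pzq = λ r hp hq → let up , near = cross-leg hp hq (rotated⇒ r) in inj₁ near , up
          ; cross-qpz = λ {z} {p} {q} r hp hq →
              let up , near = cross-hypotenuse hp hq (begin
                    J (d p z)              ≈⟨ J-split p q z ⟩
                    J (d p q) ∙ J (d q z)  ≈⟨ ∙-cong (rotated-flip r) (rotated-back r) ⟩
                    d z q ∙ d p q          ≈⟨ comm (d z q) (d p q) ⟩
                    d p q ∙ d z q          ∎)
              in inj₁ near , up
          ; cross-pqz = λ r hp hq → let down , near = cross-leg hp hq (rotated-back-flip r) in inj₂ near , down
          ; cross-qzp = λ {z} {p} {q} r hp hq →
              let down , near = cross-hypotenuse hp hq (begin
                    J (d z p)              ≈⟨ J-split z q p ⟩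
                    J (d z q) ∙ J (d q p)  ≈⟨ ∙-cong (rotated-flip r) (rotated-back r) ⟩
                    d p q ∙ d z q          ∎)
              in inj₂ near , down
          ; ¬both-near = ¬both-near
          }
          where
          ¬both-near : ∀ {z p q} → Rotated z p q → H (d p z) → H (d q z) → Near z p → ¬ Near z q
          ¬both-near r hp hq (inj₂ h) _        = apart (rotated⇒ r) hp hq h
          ¬both-near r hp hq (inj₁ _) (inj₁ h) = apart (rotated-back-flip r) hq hp h
          -- With p near above and q near below, the turned vectors are qz and pz, so the two
          -- conditions say that qp and pq are both positive.
          ¬both-near {z} {p} {q} r hp hq (inj₁ h) (inj₂ h′) =
            ¬H-inverse (displacement-flip q p)
              (H-resp (≈-trans (≈-trans (∙-congˡ (rotated-flip r)) (comm (d z p) (d q z))) (chasles q z p)) h)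
              (H-resp (≈-trans (≈-trans (∙-congˡ (rotated-back r)) (comm (d z q) (d p z))) (chasles p z q)) h′)

    module _ {n} (point : Fin n → Carrier) (distinct : Injective _≡_ _≈_ point)
             (≈? : ∀ z p q → Dec (J (point p ∙ point z ⁻¹) ≈ point q ∙ point z ⁻¹))
             (H?  : ∀ z p → Dec (H (point p ∙ point z ⁻¹)))
             (HJ? : ∀ z p → Dec (H (J (point p ∙ point z ⁻¹))))
             (H⁻? : ∀ z p → Dec (H ((point p ∙ point z ⁻¹) ∙ J (point z ∙ point p ⁻¹))))
             (H⁺? : ∀ z p → Dec (H ((point p ∙ point z ⁻¹) ∙ J (point p ∙ point z ⁻¹)))) where

      d : Fin n → Fin n → Carrier
      d z p = point p ∙ point z ⁻¹

      -- The condition `z ≢ p` rules out the solution p = q = z; the other two inequalities between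
      -- the points follow from it.
      Rotated : Fin n → Fin n → Fin n → Set
      Rotated z p q = z ≢ p × J (d z p) ≈ d z q

      private
        chasles : Displacement d
        chasles z p q = begin
          (point p ∙ point z ⁻¹) ∙ (point q ∙ point p ⁻¹)  ≈⟨ comm _ _ ⟩
          (point q ∙ point p ⁻¹) ∙ (point p ∙ point z ⁻¹)  ≈⟨ assoc _ _ _ ⟩
          point q ∙ (point p ⁻¹ ∙ (point p ∙ point z ⁻¹))  ≈⟨ ∙-congˡ (\\-leftDividesʳ (point p) (point z ⁻¹)) ⟩
          point q ∙ point z ⁻¹                             ∎

        chasles-mirrored : Displacement (flip d)
        chasles-mirrored z p q = ≈-trans (comm (d p z) (d q p)) (chasles q p z)

        -- The vertical order is the order by `H` after a quarter turn, so it is linear for the same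
        -- reason as the horizontal one.
        chasles-rotated : Displacement (λ z p → J (d p z))
        chasles-rotated z p q = ≈-trans (≈-sym (J-∙ (d p z) (d q p))) (J-cong (chasles-mirrored z p q))

        separated : ∀ {z p} → d z p ≈ ε → z ≡ p
        separated {z} {p} eq = distinct (≈-sym (x∙y⁻¹≈ε⇒x≈y (point p) (point z) eq))

        rotated⇒ : ∀ {z p q} → Rotated z p q → J (d z p) ≈ d z q
        rotated⇒ = proj₂

      configuration : Configuration n
      configuration = record
        { _≺_      = λ z p → H (d z p)
        ; _≺′_     = λ z p → H (J (d p z))
        ; Rotated  = Rotated
        ; _≺?_     = H?
        ; _≺′?_    = λ z p → HJ? p z
        ; rotated? = λ z p q → ¬? (z Fin.≟ p) ×-dec ≈? z p q
        ; ≺-isStrictTotalOrder  = ≺-isStrictTotalOrder chasles separated H?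
        ; ≺′-isStrictTotalOrder = ≺-isStrictTotalOrder chasles-rotated
            (λ eq → ≡.sym (separated (J-injective-ε eq))) (λ z p → HJ? p z)
        ; distinct₁₂ = proj₁
        ; distinct₁₃ = λ { {z} (z≢p , eq) refl → z≢p (separated (J-injective-ε (≈-trans eq (displacement-ε chasles z)))) }
        ; distinct₂₃ = λ { (z≢p , eq) refl → z≢p (separated (J-fixed eq)) }
        -- For two centres of the same pair, the vector between them is fixed by `J`.
        ; unique₁ = λ {z} {z′} {p} {q} (_ , eq) (_ , eq′) → separated (J-fixed (∙-cancelʳ (J (d z′ p)) _ _ (begin
            J (d z z′) ∙ J (d z′ p)  ≈⟨ J-∙ (d z z′) (d z′ p) ⟨
            J (d z z′ ∙ d z′ p)      ≈⟨ J-cong (chasles z z′ p) ⟩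
            J (d z p)                ≈⟨ eq ⟩
            d z q                    ≈⟨ chasles z z′ q ⟨
            d z z′ ∙ d z′ q          ≈⟨ ∙-congˡ eq′ ⟨
            d z z′ ∙ J (d z′ p)      ∎)))
        ; unique₂ = λ {z} {p} {p′} {q} r r′ → distinct (∙-cancelʳ (point z ⁻¹) _ _ (begin
            d z p      ≈⟨ rotated-back-flip chasles rotated⇒ H⁻? H⁺? r ⟨
            J (d q z)  ≈⟨ rotated-back-flip chasles rotated⇒ H⁻? H⁺? r′ ⟩
            d z p′     ∎))
        ; unique₃ = λ {z} (_ , eq) (_ , eq′) → distinct (∙-cancelʳ (point z ⁻¹) _ _ (≈-trans (≈-sym eq) eq′))
        ; sided    = sided chasles rotated⇒ H⁻? H⁺?
        -- The half turn: for `flip d` the lemma `rotated-flip` takes the place of the defining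
        -- equation of `Rotated`.
        ; mirrored = sided chasles-mirrored (rotated-flip chasles rotated⇒ H⁻? H⁺?) (λ z p → H⁻? p z) (λ z p → H⁺? p z)
        }

open Planes

-- Signs of Cauchy sequences, and the Euclidean plane as a `Plane`.

module Reals where
  import Data.Nat as ℕ
  open import Data.Rational as ℚ using (ℚ; 0ℚ; ½; _+_; _*_; _-_; -_; ∣_∣; _<_; _≤_)
  import Data.Rational.Properties as ℚ
  import Algebra.Construct.DirectProduct as DirectProduct
  open import Tactic.RingSolver using (solve-∀)
  open import Tactic.RingSolver.Core.AlmostCommutativeRing using (AlmostCommutativeRing; fromCommutativeRing)

  ℚ-ring : AlmostCommutativeRing 0ℓ 0ℓ
  ℚ-ring = fromCommutativeRing ℚ.+-*-commutativeRing (λ p → dec⇒maybe (0ℚ ℚ.≟ p))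

  private
    variable
      f g : ℕ → ℚ

  p≤∣p∣ : ∀ p → p ≤ ∣ p ∣
  p≤∣p∣ p with ℚ.≤-total 0ℚ p
  ... | inj₁ 0≤p = ℚ.≤-reflexive (sym (ℚ.0≤p⇒∣p∣≡p 0≤p))
  ... | inj₂ p≤0 = ℚ.≤-trans p≤0 (ℚ.0≤∣p∣ p)

  -p<q : ∀ {p q} → ∣ p ∣ < q → - q < p
  -p<q {p} {q} p<q = subst (- q <_) (neg-involutive p) (ℚ.neg-antimono-<
    (ℚ.≤-<-trans (p≤∣p∣ (- p)) (subst (_< q) (sym (ℚ.∣-p∣≡∣p∣ p)) p<q)))
    where
    neg-involutive : ∀ a → - (- a) ≡ a
    neg-involutive = solve-∀ ℚ-ring

  ∣p∣≤ : ∀ {p q} → p ≤ q → - p ≤ q → ∣ p ∣ ≤ q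
  ∣p∣≤ {p} p≤q -p≤q with ℚ.∣p∣≡p∨∣p∣≡-p p
  ... | inj₁ eq = subst (_≤ _) (sym eq) p≤q
  ... | inj₂ eq = subst (_≤ _) (sym eq) -p≤q

  0<p*q : ∀ {p q} → 0ℚ < p → 0ℚ < q → 0ℚ < p * q
  0<p*q {p} {q} 0<p 0<q = subst (_< p * q) (ℚ.*-zeroʳ p) (ℚ.*-monoʳ-<-pos p {{ℚ.positive 0<p}} 0<q)

  0≤p*p : ∀ p → 0ℚ ≤ p * p
  0≤p*p p with ℚ.≤-total 0ℚ p
  ... | inj₁ 0≤p = subst (_≤ p * p) (ℚ.*-zeroʳ p) (ℚ.*-monoˡ-≤-nonNeg p {{ℚ.nonNegative 0≤p}} 0≤p)
  ... | inj₂ p≤0 = subst (_≤ p * p) (ℚ.*-zeroʳ p) (ℚ.*-monoˡ-≤-nonPos p {{ℚ.nonPositive p≤0}} p≤0)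

  Null : (ℕ → ℚ) → Set
  Null f = ∀ ε → 0ℚ < ε → ∃[ N ] ∀ n → N ℕ.≤ n → ∣ f n ∣ < ε

  -- The constructive strict order: the sequence stays above a fixed positive rational, so
  -- positivity survives adding a null sequence.
  Pos : (ℕ → ℚ) → Set
  Pos f = ∃[ δ ] 0ℚ < δ × (∃[ N ] ∀ n → N ℕ.≤ n → δ < f n)

  null-cong : (∀ n → f n ≡ g n) → Null f → Null g
  null-cong f≡g null-f ε 0<ε with N , h ← null-f ε 0<ε =
    N , λ n n≥ → subst (λ p → ∣ p ∣ < ε) (f≡g n) (h n n≥)

  pos-cong : (∀ n → f n ≡ g n) → Pos f → Pos g
  pos-cong f≡g (δ , 0<δ , N , h) = δ , 0<δ , N , λ n n≥ → subst (δ <_) (f≡g n) (h n n≥)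

  null-+ : Null f → Null g → Null (λ n → f n + g n)
  null-+ {f} {g} null-f null-g ε 0<ε
    with M , hf ← null-f (½ * ε) (0<½ε 0<ε) | N , hg ← null-g (½ * ε) (0<½ε 0<ε) =
    M ℕ.⊔ N , λ n n≥ → ≤½+<½ ε (ℚ.∣p+q∣≤∣p∣+∣q∣ (f n) (g n)) (hf n (⊔ˡ n≥)) (hg n (⊔ʳ {M} n≥))

  null-neg : Null f → Null (λ n → - f n)
  null-neg {f} null-f ε 0<ε with N , h ← null-f ε 0<ε =
    N , λ n n≥ → subst (_< ε) (sym (ℚ.∣-p∣≡∣p∣ (f n))) (h n n≥)

  null-0 : Null (λ _ → 0ℚ)
  null-0 ε 0<ε = 0 , λ _ _ → 0<ε

  null-*ˡ : EventuallyBounded g → Null f → Null (λ n → g n * f n)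
  null-*ˡ {g} {f} (B , B>0 , M , bg) null-f ε 0<ε
    with δ , 0<δ , Bδ≡ε ← scale B {{B>0}} 0<ε
    with N , hf ← null-f δ 0<δ =
    M ℕ.⊔ N , λ n n≥ → bound-* B {{B>0}} (g n) (f n) Bδ≡ε (bg n (⊔ˡ n≥)) (hf n (⊔ʳ {M} n≥))

  null-square : Null (λ n → f n * f n + g n * g n) → Null f × Null g
  null-square {f} {g} null = first {f} {g} null , first {g} {f} (null-cong (λ n → ℚ.+-comm (f n * f n) (g n * g n)) null)
    where
    first : ∀ {f g : ℕ → ℚ} → Null (λ n → f n * f n + g n * g n) → Null f
    first {f} {g} null ε 0<ε with N , h ← null (ε * ε) (0<p*q 0<ε 0<ε) = N , λ n n≥ → ℚ.≰⇒> λ ε≤ → ℚ.<-irrefl refl (begin-strict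
      ε * ε                  ≤⟨ ℚ.*-monoˡ-≤-nonNeg ε {{ℚ.nonNegative (ℚ.<⇒≤ 0<ε)}} ε≤ ⟩
      ε * ∣ f n ∣            ≤⟨ ℚ.*-monoʳ-≤-nonNeg ∣ f n ∣ {{ℚ.∣-∣-nonNeg (f n)}} ε≤ ⟩
      ∣ f n ∣ * ∣ f n ∣      ≡⟨ ℚ.∣p*q∣≡∣p∣*∣q∣ (f n) (f n) ⟨
      ∣ f n * f n ∣          ≡⟨ ℚ.0≤p⇒∣p∣≡p (0≤p*p (f n)) ⟩
      f n * f n              ≡⟨ ℚ.+-identityʳ (f n * f n) ⟨
      f n * f n + 0ℚ         ≤⟨ ℚ.+-monoʳ-≤ (f n * f n) (0≤p*p (g n)) ⟩
      f n * f n + g n * g n  ≤⟨ p≤∣p∣ _ ⟩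
      ∣ f n * f n + g n * g n ∣ <⟨ h n n≥ ⟩
      ε * ε                  ∎)
      where open ℚ.≤-Reasoning

  pos-+ : Pos f → Pos g → Pos (λ n → f n + g n)
  pos-+ (δ , 0<δ , M , hf) (η , 0<η , N , hg) =
    δ + η , ℚ.+-mono-< 0<δ 0<η , M ℕ.⊔ N , λ n n≥ → ℚ.+-mono-< (hf n (⊔ˡ n≥)) (hg n (⊔ʳ {M} n≥))

  pos-* : Pos f → Pos g → Pos (λ n → f n * g n)
  pos-* {f} {g} (δ , 0<δ , M , hf) (η , 0<η , N , hg) =
    δ * η , 0<p*q 0<δ 0<η ,
    M ℕ.⊔ N , λ n n≥ → ℚ.<-trans
      (ℚ.*-monoʳ-<-pos δ {{ℚ.positive 0<δ}} (hg n (⊔ʳ {M} n≥)))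
      (ℚ.*-monoˡ-<-pos (g n) {{ℚ.positive (ℚ.<-trans 0<η (hg n (⊔ʳ {M} n≥)))}} (hf n (⊔ˡ n≥)))

  pos+null : Pos f → Null g → Pos (λ n → f n + g n)
  pos+null {f} {g} (δ , 0<δ , M , hf) null-g with N , hg ← null-g (½ * δ) (0<½ε 0<δ) =
    ½ * δ , 0<½ε 0<δ , M ℕ.⊔ N , λ n n≥ → subst (_< f n + g n) half
      (ℚ.+-mono-< (hf n (⊔ˡ n≥)) (-p<q (hg n (⊔ʳ {M} n≥))))
    where
    cancel : ∀ a → (a + a) + - a ≡ a
    cancel = solve-∀ ℚ-ring
    half : δ + - (½ * δ) ≡ ½ * δ
    half = trans (cong (_+ - (½ * δ)) (sym (½ε+½ε δ))) (cancel (½ * δ))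

  ¬pos-null : Pos f → ¬ Null f
  ¬pos-null (δ , 0<δ , M , hf) null-f with N , h ← null-f δ 0<δ =
    ℚ.<-irrefl refl (ℚ.<-trans (hf (M ℕ.⊔ N) (ℕ.m≤m⊔n M N))
      (ℚ.≤-<-trans (p≤∣p∣ _) (h (M ℕ.⊔ N) (ℕ.m≤n⊔m M N))))

  -- The sign of f is read off a single rational term, which makes this constructive.
  cauchy-null : Cauchy f → ¬ Pos f → ¬ Pos (λ n → - f n) → Null f
  cauchy-null {f} cf ¬pos ¬neg ε 0<ε with N , h ← cf (½ * ε) (0<½ε 0<ε) =
    N , λ n n≥ → ≤½+≤½ n n≥
    where
    open ℚ.≤-Reasoning
    positive : ∀ {g : ℕ → ℚ} → (∀ n → N ℕ.≤ n → ∣ g N - g n ∣ < ½ * ε) → ½ * ε < g N → Pos g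
    positive {g} h ½ε<g = g N - ½ * ε , subst (_< g N - ½ * ε) (ℚ.+-inverseʳ (½ * ε)) (ℚ.+-monoˡ-< (- (½ * ε)) ½ε<g) ,
      N , λ n n≥ → subst (g N - ½ * ε <_) (cancel (g N) (g n)) (ℚ.+-monoʳ-< (g N) (ℚ.neg-antimono-< (ℚ.≤-<-trans (p≤∣p∣ (g N - g n)) (h n n≥))))
      where
      cancel : ∀ a b → a + - (a - b) ≡ b
      cancel = solve-∀ ℚ-ring
    near : ∀ n → N ℕ.≤ n → ∣ f N - f n ∣ < ½ * ε
    near n = h N n ℕ.≤-refl
    reversed : ∀ a b → ∣ (- a) - (- b) ∣ ≡ ∣ a - b ∣
    reversed a b = trans (cong ∣_∣ (negate a b)) (ℚ.∣-p∣≡∣p∣ (a - b))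
      where
      negate : ∀ a b → (- a) - (- b) ≡ - (a - b)
      negate = solve-∀ ℚ-ring
    ∣fN∣≤ : ∣ f N ∣ ≤ ½ * ε
    ∣fN∣≤ = ∣p∣≤ (ℚ.≮⇒≥ λ lt → ¬pos (positive near lt))
      (ℚ.≮⇒≥ λ lt → ¬neg (positive (λ n n≥ → subst (_< ½ * ε) (sym (reversed (f N) (f n))) (near n n≥)) lt))
    ≤½+≤½ : ∀ n → N ℕ.≤ n → ∣ f n ∣ < ε
    ≤½+≤½ n n≥ = begin-strict
      ∣ f n ∣                     ≡⟨ cong ∣_∣ (difference+ (f n) (f N)) ⟩
      ∣ (f n - f N) + f N ∣       ≤⟨ ℚ.∣p+q∣≤∣p∣+∣q∣ (f n - f N) (f N) ⟩
      ∣ f n - f N ∣ + ∣ f N ∣     <⟨ ℚ.+-monoˡ-< ∣ f N ∣ (h n N n≥ ℕ.≤-refl) ⟩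
      ½ * ε + ∣ f N ∣             ≤⟨ ℚ.+-monoʳ-≤ (½ * ε) ∣fN∣≤ ⟩
      ½ * ε + ½ * ε               ≡⟨ ½ε+½ε ε ⟩
      ε                           ∎

  negᵣ : ℝ → ℝ
  negᵣ x = mkℝ (λ n → - seq x n) (neg-cauchy {seq x} (cauchy x))

  ≃-pointwise : ∀ {x y} → (∀ n → seq x n ≡ seq y n) → x ≃ y
  ≃-pointwise {x} {y} x≡y = mk≃ (null-cong
    (λ n → trans (sym (ℚ.+-inverseʳ (seq x n))) (cong (λ p → seq x n - p) (x≡y n))) null-0)

  ℝ-+-abelianGroup : AbelianGroup 0ℓ 0ℓ
  ℝ-+-abelianGroup = record
    { Carrier = ℝ
    ; _≈_ = _≃_
    ; _∙_ = _+ᵣ_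
    ; ε = 0ᵣ
    ; _⁻¹ = negᵣ
    ; isAbelianGroup = record
      { isGroup = record
        { isMonoid = record
          { isSemigroup = record
            { isMagma = record
              { isEquivalence = record
                { refl  = ≃-pointwise (λ _ → refl)
                ; sym   = λ {x} {y} e → mk≃ (null-cong (λ n → reversed (seq x n) (seq y n)) (null-neg (null e)))
                ; trans = λ {x} {y} {z} e e′ → mk≃ (null-cong (λ n → chain (seq x n) (seq y n) (seq z n))
                                                    (null-+ (null e) (null e′)))
                }
              ; ∙-cong = λ {x} {y} {u} {v} e e′ → mk≃ (null-cong
                  (λ n → sum-of-differences (seq x n) (seq y n) (seq u n) (seq v n)) (null-+ (null e) (null e′)))
              }
            ; assoc = λ x y z → ≃-pointwise (λ n → ℚ.+-assoc (seq x n) (seq y n) (seq z n))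
            }
          ; identity = (λ x → ≃-pointwise (λ n → ℚ.+-identityˡ (seq x n)))
                     , (λ x → ≃-pointwise (λ n → ℚ.+-identityʳ (seq x n)))
          }
        ; inverse = (λ x → ≃-pointwise (λ n → ℚ.+-inverseˡ (seq x n)))
                  , (λ x → ≃-pointwise (λ n → ℚ.+-inverseʳ (seq x n)))
        ; ⁻¹-cong = λ {x} {y} e → mk≃ (null-cong (λ n → ℚ.neg-distrib-+ (seq x n) (- seq y n)) (null-neg (null e)))
        }
      ; comm = λ x y → ≃-pointwise (λ n → ℚ.+-comm (seq x n) (seq y n))
      }
    }
    where
    reversed : ∀ a b → - (a - b) ≡ b - a
    reversed = solve-∀ ℚ-ring
    chain : ∀ a b c → (a - b) + (b - c) ≡ a - c
    chain = solve-∀ ℚ-ring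

  -- `H` is the open right half-plane with the upward vertical ray, so points are ordered
  -- lexicographically and those on a common vertical line do not tie.
  euclideanPlane : Plane
  euclideanPlane = record
    { vectors = DirectProduct.abelianGroup ℝ-+-abelianGroup ℝ-+-abelianGroup
    ; J       = λ (x , y) → negᵣ y , x
    ; J-cong  = λ (e , e′) → ⁻¹-cong e′ , e
    ; J-∙     = λ (_ , y) (_ , y′) → ≃-pointwise (λ n → ℚ.neg-distrib-+ (seq y n) (seq y′ n)) , ≃-refl
    ; J-J     = λ _ → ≃-refl , ≃-refl
    ; H       = λ (x , y) → Pos (seq x) ⊎ (Null (seq x) × Pos (seq y))
    ; H-resp  = λ where
        (e , _)  (inj₁ px)        → inj₁ (pos-resp e px)
        (e , e′) (inj₂ (nx , py)) → inj₂ (null-resp e nx , pos-resp e′ py)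
    ; H-∙     = λ where
        (inj₁ px) (inj₁ px′) → inj₁ (pos-+ px px′)
        (inj₁ px) (inj₂ (nx′ , _)) → inj₁ (pos+null px nx′)
        {x , _} {x′ , _} (inj₂ (nx , _)) (inj₁ px′) →
          inj₁ (pos-cong (λ n → ℚ.+-comm (seq x′ n) (seq x n)) (pos+null px′ nx))
        (inj₂ (nx , py)) (inj₂ (nx′ , py′)) → inj₂ (null-+ nx nx′ , pos-+ py py′)
    ; ¬H-ε    = λ where
        (inj₁ p0)       → ¬pos-null p0 null-0
        (inj₂ (_ , p0)) → ¬pos-null p0 null-0
    ; H-total = λ {(x , y)} ¬h ¬h⁻¹ →
        let null-x = cauchy-null (cauchy x) (λ px → ¬h (inj₁ px)) (λ px → ¬h⁻¹ (inj₁ px))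
            null-y = cauchy-null (cauchy y) (λ py → ¬h (inj₂ (null-x , py)))
                                            (λ py → ¬h⁻¹ (inj₂ (null-neg null-x , py)))
        in ≃0 {x} null-x , ≃0 {y} null-y
    }
    where
    open AbelianGroup ℝ-+-abelianGroup using (⁻¹-cong) renaming (refl to ≃-refl)
    ≃0 : ∀ {x} → Null (seq x) → x ≃ 0ᵣ
    ≃0 {x} nx = mk≃ (null-cong (λ n → sym (ℚ.+-identityʳ (seq x n))) nx)
    target : ∀ a b → a + - (a - b) ≡ b
    target = solve-∀ ℚ-ring
    pos-resp : ∀ {x y} → x ≃ y → Pos (seq x) → Pos (seq y)
    pos-resp {x} {y} e p = pos-cong (λ n → target (seq x n) (seq y n)) (pos+null p (null-neg (null e)))
    null-resp : ∀ {x y} → x ≃ y → Null (seq x) → Null (seq y)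
    null-resp {x} {y} e p = null-cong (λ n → target (seq x n) (seq y n)) (null-+ p (null-neg (null e)))

  module E = Plane euclideanPlane

  coordinates : Point → E.Carrier
  coordinates A = xc A , yc A

  QuarterTurn : Point → Point → Point → Set
  QuarterTurn A B C = E.J (coordinates B E.∙ coordinates A E.⁻¹) E.≈ coordinates C E.∙ coordinates A E.⁻¹

  ≃0⇒null : ∀ {x} → x ≃ 0ᵣ → Null (seq x)
  ≃0⇒null {x} e = null-cong (λ n → ℚ.+-identityʳ (seq x n)) (null e)

  -- With v = AB and w = AC, the identity
  -- ∣w − Jv∣² ∣w + Jv∣² = (∣v∣² − ∣w∣²)² + 4 (v·w)² shows that w = ± Jv.
  right-angle : ∀ {A B C} → Nondegenerate A B C → Isosceles A B C → dot A B C ≃ 0ᵣ →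
                ¬ QuarterTurn A B C → ¬ QuarterTurn A C B → ⊥
  right-angle {A} {B} {C} nondeg isosceles dot≃0 ¬B→C ¬C→B = cases isosceles
    where
    x = xc B -ᵣ xc A
    y = yc B -ᵣ yc A
    u = xc C -ᵣ xc A
    t = yc C -ᵣ yc A
    minus plus : ℝ
    minus = (u +ᵣ y) *ᵣ (u +ᵣ y) +ᵣ (t -ᵣ x) *ᵣ (t -ᵣ x)
    plus  = (u -ᵣ y) *ᵣ (u -ᵣ y) +ᵣ (t +ᵣ x) *ᵣ (t +ᵣ x)

    degenerate : ∀ {f g h k : ℕ → ℚ} → EventuallyBounded f → EventuallyBounded h → Null g → Null k →
                 Null (λ n → f n * g n - h n * k n)
    degenerate bf bh ng nk = null-+ (null-*ˡ bf ng) (null-neg (null-*ˡ bh nk))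

    bounded : ∀ z → EventuallyBounded (seq z)
    bounded z = cauchy⇒bounded (cauchy z)

    0≤p²+q² : ∀ a b → 0ℚ ≤ a * a + b * b
    0≤p²+q² a b = ℚ.+-mono-≤ (0≤p*p a) (0≤p*p b)

    ¬neg-squares : ∀ {f g : ℕ → ℚ} → ¬ Pos (λ n → - (f n * f n + g n * g n))
    ¬neg-squares {f} {g} (δ , 0<δ , N , h) = ℚ.<-irrefl refl
      (ℚ.<-≤-trans (ℚ.<-trans 0<δ (h N ℕ.≤-refl)) (ℚ.neg-antimono-≤ (0≤p²+q² (f N) (g N))))

    product : ∀ x y u t →
      ((x * x + y * y) - (u * u + t * t)) * ((x * x + y * y) - (u * u + t * t)) +
        (((x * u + y * t) + (x * u + y * t)) * ((x * u + y * t) + (x * u + y * t))) ≡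
      ((u + y) * (u + y) + (t - x) * (t - x)) * ((u - y) * (u - y) + (t + x) * (t + x))
    product = solve-∀ ℚ-ring

    cases : Isosceles A B C → ⊥
    cases (inj₁ AB≃AC) =
      -- That a product is null does not decide which factor is. A nonnegative number is null once
      -- its positivity is refuted: if `minus` were positive, then `plus` could not be, and its
      -- vanishing would give the other turn.
      ¬B→C (turn₁ (cauchy-null (cauchy minus) (λ p →
        ¬C→B (turn₂ (cauchy-null (cauchy plus) (λ q → ¬pos-null (pos-* p q) null-product)
          (¬neg-squares {seq (u -ᵣ y)} {seq (t +ᵣ x)}))))
        (¬neg-squares {seq (u +ᵣ y)} {seq (t -ᵣ x)})))
      where
      difference twice-dot : ℝ
      difference = dist² A B -ᵣ dist² A C
      twice-dot  = dot A B C +ᵣ dot A B C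
      null-twice-dot : Null (seq twice-dot)
      null-twice-dot = null-+ (≃0⇒null dot≃0) (≃0⇒null dot≃0)
      null-product : Null (λ n → seq minus n * seq plus n)
      null-product = null-cong (λ n → product (seq x n) (seq y n) (seq u n) (seq t n))
        (null-+ (null-*ˡ (bounded difference) (null AB≃AC))
                (null-*ˡ (bounded twice-dot) null-twice-dot))
      turn₁ : Null (seq minus) → QuarterTurn A B C
      turn₁ null-minus with null-u+y , null-t-x ← null-square {seq (u +ᵣ y)} {seq (t -ᵣ x)} null-minus =
        mk≃ (null-cong (λ n → negate (seq u n) (seq y n)) (null-neg null-u+y)) ,
        mk≃ (null-cong (λ n → reversed (seq t n) (seq x n)) (null-neg null-t-x))
        where
        negate : ∀ a b → - (a + b) ≡ - b - a
        negate = solve-∀ ℚ-ring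
        reversed : ∀ a b → - (a - b) ≡ b - a
        reversed = solve-∀ ℚ-ring
      turn₂ : Null (seq plus) → QuarterTurn A C B
      turn₂ null-plus with null-u-y , null-t+x ← null-square {seq (u -ᵣ y)} {seq (t +ᵣ x)} null-plus =
        mk≃ (null-cong (λ n → negate (seq t n) (seq x n)) (null-neg null-t+x)) ,
        mk≃ null-u-y
        where
        negate : ∀ a b → - (a + b) ≡ - a - b
        negate = solve-∀ ℚ-ring
    -- BC is the hypotenuse. By Pythagoras its equality with the leg BA makes AC vanish, and the
    -- triangle is degenerate; the last case is the same with AB.
    cases (inj₂ (inj₁ BC≃BA)) =
      nondeg (mk≃ (null-cong (λ n → sym (ℚ.+-identityʳ (seq (det A B C) n)))
        (degenerate (bounded x) (bounded y) (proj₂ null-ut) (proj₁ null-ut))))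
      where
      length² : ∀ xa ya xb yb xc yc →
        (((xc - xb) * (xc - xb) + (yc - yb) * (yc - yb)) - ((xa - xb) * (xa - xb) + (ya - yb) * (ya - yb))) +
          (((xb - xa) * (xc - xa) + (yb - ya) * (yc - ya)) + ((xb - xa) * (xc - xa) + (yb - ya) * (yc - ya))) ≡
        (xc - xa) * (xc - xa) + (yc - ya) * (yc - ya)
      length² = solve-∀ ℚ-ring
      null-ut : Null (seq u) × Null (seq t)
      null-ut = null-square (null-cong
        (λ n → length² (seq (xc A) n) (seq (yc A) n) (seq (xc B) n) (seq (yc B) n) (seq (xc C) n) (seq (yc C) n))
        (null-+ (null BC≃BA) (null-+ (≃0⇒null dot≃0) (≃0⇒null dot≃0))))
    cases (inj₂ (inj₂ CA≃CB)) =
      nondeg (mk≃ (null-cong (λ n → commute (seq u n) (seq t n) (seq x n) (seq y n))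
        (degenerate (bounded t) (bounded u) (proj₁ null-xy) (proj₂ null-xy))))
      where
      commute : ∀ u t x y → t * x - u * y ≡ (x * t - y * u) - 0ℚ
      commute = solve-∀ ℚ-ring
      length² : ∀ xa ya xb yb xc yc →
        (((xb - xa) * (xc - xa) + (yb - ya) * (yc - ya)) + ((xb - xa) * (xc - xa) + (yb - ya) * (yc - ya))) +
          - (((xa - xc) * (xa - xc) + (ya - yc) * (ya - yc)) - ((xb - xc) * (xb - xc) + (yb - yc) * (yb - yc))) ≡
        (xb - xa) * (xb - xa) + (yb - ya) * (yb - ya)
      length² = solve-∀ ℚ-ring
      null-xy : Null (seq x) × Null (seq y)
      null-xy = null-square (null-cong
        (λ n → length² (seq (xc A) n) (seq (yc A) n) (seq (xc B) n) (seq (yc B) n) (seq (xc C) n) (seq (yc C) n))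
        (null-+ (null-+ (≃0⇒null dot≃0) (≃0⇒null dot≃0)) (null-neg (null CA≃CB))))

  det-cyclic : ∀ {A B C} → det B C A ≃ 0ᵣ → det A B C ≃ 0ᵣ
  det-cyclic {A} {B} {C} e = mk≃ (null-cong
    (λ n → cycle (seq (xc A) n) (seq (yc A) n) (seq (xc B) n) (seq (yc B) n) (seq (xc C) n) (seq (yc C) n)) (null e))
    where
    cycle : ∀ xa ya xb yb xc yc →
      ((xc - xb) * (ya - yb) - (yc - yb) * (xa - xb)) - 0ℚ ≡ ((xb - xa) * (yc - ya) - (yb - ya) * (xc - xa)) - 0ℚ
    cycle = solve-∀ ℚ-ring

  -- The vertex of the right angle is given by `right`, but the sense of the turn cannot be computed
  -- from the coordinates; hence the form with six negations.
  isoscelesRight⇒quarterTurn : ∀ {A B C} → IsoscelesRight A B C →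
    ¬ QuarterTurn A B C → ¬ QuarterTurn A C B → ¬ QuarterTurn B C A →
    ¬ QuarterTurn B A C → ¬ QuarterTurn C A B → ¬ QuarterTurn C B A → ⊥
  isoscelesRight⇒quarterTurn {A} {B} {C} (mkIsoscelesRight nondeg isosceles right) ¬ABC ¬ACB ¬BCA ¬BAC ¬CAB ¬CBA
    with right
  ... | inj₁ dotA        = right-angle {A} {B} {C} nondeg isosceles dotA ¬ABC ¬ACB
  ... | inj₂ (inj₁ dotB) = right-angle {B} {C} {A} (λ e → nondeg (det-cyclic {A} {B} {C} e)) (rotate isosceles) dotB ¬BCA ¬BAC
    where
    rotate : Isosceles A B C → Isosceles B C A
    rotate (inj₁ a)        = inj₂ (inj₂ a)
    rotate (inj₂ (inj₁ b)) = inj₁ b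
    rotate (inj₂ (inj₂ c)) = inj₂ (inj₁ c)
  ... | inj₂ (inj₂ dotC) = right-angle {C} {A} {B}
      (λ e → nondeg (det-cyclic {A} {B} {C} (det-cyclic {B} {C} {A} e))) (rotate isosceles) dotC ¬CAB ¬CBA
    where
    rotate : Isosceles A B C → Isosceles C A B
    rotate (inj₁ a)        = inj₂ (inj₁ a)
    rotate (inj₂ (inj₁ b)) = inj₂ (inj₂ b)
    rotate (inj₂ (inj₂ c)) = inj₁ c

open Reals

-- From counts of point sets to the bound with the floor.

module Conclusion where
  open import Data.Nat as ℕ using ()
  open import Data.Integer as ℤ using (+_)
  import Data.Integer.Properties as ℤ
  import Data.Integer.DivMod as ℤ
  open import Data.Rational as ℚ using (ℚ; 1ℚ; _/_; floor)
  import Data.Rational.Properties as ℚ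
  import Data.Rational.Unnormalised as ℚᵘ
  import Data.Rational.Unnormalised.Properties as ℚᵘ
  open import Tactic.RingSolver using (solve-∀)

  ¬¬-∀ : ∀ {n} {P : Fin n → Set} → (∀ i → ¬ ¬ P i) → ¬ ¬ (∀ i → P i)
  ¬¬-∀ = Fin.sequence (RawMonad.rawApplicative ¬¬-Monad)

  ≤-floor : ∀ i p → i / 1 ℚ.≤ p → i ℤ.≤ floor p
  ≤-floor i p@record{} i≤p with ℚᵘ.*≤* i*d≤m ← ℚᵘ.≤-respˡ-≃ (ℚ.toℚᵘ-fromℚᵘ (ℚᵘ.mkℚᵘ i 0)) (ℚ.toℚᵘ-mono-≤ i≤p) =
    ℤ.≮⇒≥ λ m/d<i → ℤ.<-irrefl refl (begin-strict
      m                          <⟨ ℤ.n<s[n/ℕd]*d m d ⟩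
      ℤ.suc (m ℤ./ℕ d) ℤ.* + d   ≤⟨ ℤ.*-monoʳ-≤-nonNeg (+ d) (ℤ.i<j⇒suc[i]≤j (subst (ℤ._< i) (ℤ.div-pos-is-/ℕ m d) m/d<i)) ⟩
      i ℤ.* + d                  ≤⟨ i*d≤m ⟩
      m ℤ.* ℤ.1ℤ                 ≡⟨ ℤ.*-identityʳ m ⟩
      m                          ∎)
    where
    open ℤ.≤-Reasoning
    m = ℚ.numerator p
    d = ℚ.denominatorℕ p

  ι : ℕ → ℚ
  ι n = + n / 1

  private
    ιᵘ : ∀ n → ℚ.toℚᵘ (ι n) ℚᵘ.≃ ℚᵘ.mkℚᵘ (+ n) 0
    ιᵘ n = ℚ.toℚᵘ-fromℚᵘ (ℚᵘ.mkℚᵘ (+ n) 0)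

  ι-+ : ∀ m n → ι (m ℕ.+ n) ≡ ι m ℚ.+ ι n
  ι-+ m n = ℚ.toℚᵘ-injective (ℚᵘ.≃-trans (ιᵘ (m ℕ.+ n)) (ℚᵘ.≃-trans
    (ℚᵘ.*≡* (cong (ℤ._* ℤ.1ℤ) (cong₂ ℤ._+_ (sym (ℤ.*-identityʳ (+ m))) (sym (ℤ.*-identityʳ (+ n))))))
    (ℚᵘ.≃-sym (ℚᵘ.≃-trans (ℚ.toℚᵘ-homo-+ (ι m) (ι n)) (ℚᵘ.+-cong (ιᵘ m) (ιᵘ n))))))

  ι-* : ∀ m n → ι (m ℕ.* n) ≡ ι m ℚ.* ι n
  ι-* m n = ℚ.toℚᵘ-injective (ℚᵘ.≃-trans (ιᵘ (m ℕ.* n)) (ℚᵘ.≃-trans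
    (ℚᵘ.*≡* (cong (ℤ._* ℤ.1ℤ) (ℤ.pos-* m n)))
    (ℚᵘ.≃-sym (ℚᵘ.≃-trans (ℚ.toℚᵘ-homo-* (ι m) (ι n)) (ℚᵘ.*-cong (ιᵘ m) (ιᵘ n))))))

  ι-mono : ∀ {m n} → m ℕ.≤ n → ι m ℚ.≤ ι n
  ι-mono {m} {n} m≤n = ℚ.toℚᵘ-cancel-≤ (ℚᵘ.≤-respˡ-≃ (ℚᵘ.≃-sym (ιᵘ m)) (ℚᵘ.≤-respʳ-≃ (ℚᵘ.≃-sym (ιᵘ n))
    (ℚᵘ.*≤* (ℤ.*-monoʳ-≤-nonNeg ℤ.1ℤ (ℤ.+≤+ m≤n)))))

  module _ where
    open import Data.Rational using (_+_; _*_; _-_)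

    ≤-floor-quadratic : ∀ N s → 3 ℕ.* s ℕ.+ 5 ℕ.≤ 2 ℕ.* (N ℕ.* N) →
      + s ℤ.≤ floor ((+ 2 / 3) * ((+ suc N / 1 - 1ℚ) * (+ suc N / 1 - 1ℚ)) - (+ 5 / 3))
    ≤-floor-quadratic N s bound = ≤-floor (+ s) ((+ 2 / 3) * ((+ suc N / 1 - 1ℚ) * (+ suc N / 1 - 1ℚ)) - (+ 5 / 3)) (ℚ.*-cancelˡ-≤-pos (ι 3) (begin
      ι 3 * ι s
        ≡⟨ cancel (ι 3 * ι s) (ι 5) ⟩
      (ι 3 * ι s + ι 5) - ι 5
        ≡⟨ cong (_- ι 5) (trans (ι-+ (3 ℕ.* s) 5) (cong (_+ ι 5) (ι-* 3 s))) ⟨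
      ι (3 ℕ.* s ℕ.+ 5) - ι 5
        ≤⟨ ℚ.+-monoˡ-≤ (ℚ.- ι 5) (ι-mono bound) ⟩
      ι (2 ℕ.* (N ℕ.* N)) - ι 5
        -- The closed fractions compute: `ι 2` is `ι 3 * (+ 2 / 3)` and `ι 5` is `ι 3 * (+ 5 / 3)`.
        ≡⟨ cong (_- ι 5) (trans (ι-* 2 (N ℕ.* N)) (cong (ι 2 *_) (ι-* N N))) ⟩
      (ι 3 * (+ 2 / 3)) * (ι N * ι N) - ι 3 * (+ 5 / 3)
        ≡⟨ distribute (ι 3) (+ 2 / 3) (ι N) (+ 5 / 3) ⟩
      ι 3 * ((+ 2 / 3) * (ι N * ι N) - (+ 5 / 3))
        ≡⟨ cong (λ x → ι 3 * ((+ 2 / 3) * (x * x) - (+ 5 / 3))) predecessor ⟨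
      ι 3 * ((+ 2 / 3) * ((ι (suc N) - 1ℚ) * (ι (suc N) - 1ℚ)) - (+ 5 / 3)) ∎))
      where
      open ℚ.≤-Reasoning
      cancel : ∀ a b → a ≡ (a + b) - b
      cancel = solve-∀ ℚ-ring
      cancelˡ : ∀ a b → (a + b) - a ≡ b
      cancelˡ = solve-∀ ℚ-ring
      distribute : ∀ a b x c → (a * b) * (x * x) - a * c ≡ a * (b * (x * x) - c)
      distribute = solve-∀ ℚ-ring
      predecessor : ι (suc N) - 1ℚ ≡ ι N
      predecessor = trans (cong (_- 1ℚ) (ι-+ 1 N)) (cancelˡ 1ℚ (ι N))

  module _ where
    open import Data.Nat using (_+_; _*_; _≤_; _<_)

    increasing≥1 : ∀ {n} {i j k : Fin n} → i Fin.< j → j Fin.< k → 1 ≤ increasing i j k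
    increasing≥1 {i = i} {j} {k} i<j j<k = ℕ.*-mono-≤ (1≤⟦ i Fin.<? j ⟧ i<j) (1≤⟦ j Fin.<? k ⟧ j<k)

    count≤increasing : ∀ {n s} (P : PointSet n) → S△[ P ]≡ s → s ≤ ∑³ (increasing {n})
    count≤increasing P (mkSize ts uniq exact refl) = length≤∑³ uniq increasing λ t∈ts →
      let i<j , j<k , _ = Equivalence.to (exact _) t∈ts in increasing≥1 i<j j<k

    all<1 : ∀ a b c d e f → a + b + c + d + e + f < 1 →
            a < 1 × b < 1 × c < 1 × d < 1 × e < 1 × f < 1
    all<1 a b c d e f h₆ = first a b h₂ , second a b h₂ , second (a + b) c h₃ , second (a + b + c) d h₄ ,
                           second (a + b + c + d) e h₅ , second (a + b + c + d + e) f h₆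
      where
      first : ∀ x y → x + y < 1 → x < 1
      first x y = ℕ.≤-<-trans (ℕ.m≤m+n x y)
      second : ∀ x y → x + y < 1 → y < 1
      second x y = ℕ.≤-<-trans (ℕ.m≤n+m y x)
      h₅ : a + b + c + d + e < 1
      h₅ = first (a + b + c + d + e) f h₆
      h₄ : a + b + c + d < 1
      h₄ = first (a + b + c + d) e h₅
      h₃ : a + b + c < 1
      h₃ = first (a + b + c) d h₄
      h₂ : a + b < 1
      h₂ = first (a + b) c h₃

    -- Every listed triplet gets weight at least 1, since otherwise none of its six possible quarter
    -- turns exists. That contradiction suffices, because the weight is a natural number.
    count≤rotations : ∀ {n s} (P : PointSet n) (C : Configuration n) →
      (∀ {a b c} → a ≢ b → QuarterTurn (point P a) (point P b) (point P c) → Configuration.Rotated C a b c) →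
      S△[ P ]≡ s → s ≤ ∑³ (λ a b c → ⟦ Configuration.rotated? C a b c ⟧)
    count≤rotations P C turn⇒ (mkSize ts uniq exact refl) =
      ℕ.≤-trans (length≤∑³ uniq weight 1≤weight) (∑³-increasing rot)
      where
      open Configuration C
      rot weight : Fin _ → Fin _ → Fin _ → ℕ
      rot a b c = ⟦ rotated? a b c ⟧
      weight i j k = increasing i j k * (rot i j k + rot i k j + rot j i k + rot j k i + rot k i j + rot k j i)
      no-turn : ∀ {a b c} → a ≢ b → rot a b c < 1 → ¬ QuarterTurn (point P a) (point P b) (point P c)
      no-turn {a} {b} {c} a≢b rot<1 turn = ℕ.<⇒≱ rot<1 (1≤⟦ rotated? a b c ⟧ (turn⇒ a≢b turn))
      1≤weight : ∀ {i j k} → (i , j , k) ∈ ts → 1 ≤ weight i j k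
      1≤weight {i} {j} {k} t∈ts with i<j , j<k , triangle ← Equivalence.to (exact (i , j , k)) t∈ts =
        ℕ.*-mono-≤ (increasing≥1 i<j j<k) (ℕ.≮⇒≥ λ sum<1 →
          let ijk , ikj , jik , jki , kij , kji =
                all<1 (rot i j k) (rot i k j) (rot j i k) (rot j k i) (rot k i j) (rot k j i) sum<1
              i≢j = Fin.<⇒≢ i<j
              j≢k = Fin.<⇒≢ j<k
              i≢k = Fin.<⇒≢ (Fin.<-trans i<j j<k)
          in isoscelesRight⇒quarterTurn {point P i} {point P j} {point P k} triangle
               (no-turn i≢j ijk) (no-turn i≢k ikj) (no-turn j≢k jki)
               (no-turn (i≢j ∘ sym) jik) (no-turn (i≢k ∘ sym) kij) (no-turn (j≢k ∘ sym) kji))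

    -- The claim is a decidable inequality and so stable under double negation. This permits
    -- assuming decisions for the finitely many statements about the given points.
    large-bound : ∀ {k s} (P : PointSet (5 + k)) → S△[ P ]≡ s → 3 * s + 5 ≤ 2 * ((4 + k) * (4 + k))
    large-bound {k} {s} P count = decidable-stable (3 * s + 5 ℕ.≤? 2 * ((4 + k) * (4 + k))) λ ¬bound →
      ¬¬-∀ (λ z → ¬¬-∀ λ p → ¬¬-∀ λ q → ¬¬-excluded-middle) λ ≈? →
      ¬¬-∀ (λ z → ¬¬-∀ λ p → ¬¬-excluded-middle) λ H? →
      ¬¬-∀ (λ z → ¬¬-∀ λ p → ¬¬-excluded-middle) λ HJ? →
      ¬¬-∀ (λ z → ¬¬-∀ λ p → ¬¬-excluded-middle) λ H⁻? →
      ¬¬-∀ (λ z → ¬¬-∀ λ p → ¬¬-excluded-middle) λ H⁺? →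
      let C = PlaneProperties.configuration euclideanPlane (coordinates ∘ point P) (distinct P) ≈? H? HJ? H⁻? H⁺?
      in ¬bound (quadratic-bound {s = s} C refl (ℕ.≤-trans
           (ℕ.*-monoʳ-≤ 3 (count≤rotations P C _,_ count)) (TotalBound.count≤∑degree C)))

    count-bound : ∀ {N s} → 2 ≤ N → (P : PointSet (suc N)) → S△[ P ]≡ s → 3 * s + 5 ≤ 2 * (N * N)
    -- For three and four points `∑³ increasing` evaluates to 1 and 4, and 3 · 1 + 5 = 8, 3 · 4 + 5
    -- = 17 against the required 8 and 18.
    count-bound {2} _ P count = ℕ.+-monoˡ-≤ 5 (ℕ.*-monoʳ-≤ 3 (count≤increasing P count))
    count-bound {3} _ P count = ℕ.≤-trans (ℕ.+-monoˡ-≤ 5 (ℕ.*-monoʳ-≤ 3 (count≤increasing P count))) (ℕ.n≤1+n 17)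
    -- The summed bound starts at five points: for four it would give only 3 s ≤ 17, hence s ≤ 5,
    -- one too many.
    count-bound {suc (suc (suc (suc k)))} _ P count = large-bound P count
    count-bound {1} (s≤s ())

open Conclusion

open import Data.Integer using (+_; _≤_)
open import Data.Rational using (1ℚ; _/_; _*_; _-_; floor)

theorem4 : ∀ (n : ℕ) → n ≥ 3 → ∀ (s : ℕ) → S△ n ≡ s →
    + s ≤ floor ((+ 2 / 3) * ((+ n / 1 - 1ℚ) * (+ n / 1 - 1ℚ)) - (+ 5 / 3))
theorem4 (suc N) (s≤s 2≤N) s S with P , count ← S△_≡_.attained S =
  ≤-floor-quadratic N s (count-bound 2≤N P count)
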